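{- Let $\lambda$ be a partition with $\ell(\lambda)=k$. Then, viewing $\mathrm{Sym}\subseteq \mathrm{QSym}$, \[ s_\lambda = \sum_{\sigma} (-1)^\sigma\, \mathfrak{S}^*_{(\lambda_{\sigma_1}+1-\sigma_1,\ \lambda_{\sigma_2}+2-\sigma_2,\ \dots,\ \lambda_{\sigma_k}+k-\sigma_k)}, \] where the sum is over permutations $\sigma\in S_k$ such that $\lambda_{\sigma_i}+i-\sigma_i>0$ for all $i\in\{1,\dots,k\}$.
   Context: $\mathrm{NSym}$ is the free associative algebra over $\mathbb{Q}$ on $H_1,H_2,\dots$ ($H_0=1$, $H_{ -r}=0$ for $r>0$), graded dual to $\mathrm{QSym}$ through $\langle H_{\alpha_1}\cdots H_{\alpha_k},M_\beta\rangle=\delta_{\alpha\beta}$, $M_\beta$ the monomial quasisymmetric functions; coproduct $\Delta(H_j)=\sum_i H_i\otimes H_{j-i}$. For $F\in\mathrm{QSym}$, $F^\perp$ is given by $\langle F^\perp(H),G\rangle=\langle H,FG\rangle$, and $F_{1^i}=M_{1^i}$. Let $\mathbb{B}_m=\sum_{i\ge0}(-1)^iH_{m+i}F_{1^i}^\perp$ and $\mathfrak{S}_\alpha=\mathbb{B}_{\alpha_1}\cdots\mathbb{B}_{\alpha_m}(1)$; $\{\mathfrak{S}_\alpha:\alpha\models n\}$ is a basis of $\mathrm{NSym}_n$ and $\{\mathfrak{S}^*_\alpha\}$ denotes the dual basis of $\mathrm{QSym}$. $\mathrm{Sym}$ is the subalgebra of symmetric functions in $\mathrm{QSym}$ and $s_\lambda$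 is the Schur function. $(-1)^\sigma$ is the sign of $\sigma$. -}

module Defs where

open import Data.Nat as ℕ using (ℕ; zero; suc; _∸_; _≡ᵇ_; _<ᵇ_; _≤ᵇ_)
open import Data.Bool using (Bool; true; false; if_then_else_; _∧_; not; T)
open import Data.List using (List; []; _∷_; _++_; map; concatMap; length; foldr; upTo; replicate)
open import Data.Product using (_×_; _,_)
open import Data.Integer using (+_)
open import Data.Rational using (ℚ; 0ℚ; 1ℚ; _+_; _*_; -_; _/_)

sumℕ : List ℕ → ℕ
sumℕ = foldr ℕ._+_ 0

eqL : List ℕ → List ℕ → Bool
eqL [] [] = true
eqL (x ∷ xs) (y ∷ ys) = (x ≡ᵇ y) ∧ eqL xs ys
eqL _ _ = false

dropZeros : List ℕ → List ℕ
dropZeros [] = []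
dropZeros (zero ∷ xs) = dropZeros xs
dropZeros (suc x ∷ xs) = suc x ∷ dropZeros xs

countTrue : List Bool → ℕ
countTrue [] = 0
countTrue (true ∷ bs) = suc (countTrue bs)
countTrue (false ∷ bs) = countTrue bs

allB : List Bool → Bool
allB = foldr _∧_ true

nth : List ℕ → ℕ → ℕ
nth [] _ = 0
nth (x ∷ xs) zero = x
nth (x ∷ xs) (suc i) = nth xs i

signPow : ℕ → ℚ
signPow zero = 1ℚ
signPow (suc i) = - signPow i

compsFuel : ℕ → ℕ → List (List ℕ)
compsFuel _ zero = [] ∷ []
compsFuel zero (suc n) = []
compsFuel (suc f) (suc n) =
  concatMap (λ j → map (j ∷_) (compsFuel f (suc n ∸ j))) (map suc (upTo (suc n)))

comps : ℕ → List (List ℕ)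
comps n = compsFuel n n

-- Finite formal ℚ-linear combinations.
-- In NSym, a term (c , β) stands for c · H_β = c · H_{β₁}⋯H_{βₗ}
-- (β with no zero parts, since H_0 = 1).
-- In QSym, a term (c , β) stands for c · M_β.

Lin : Set
Lin = List (ℚ × List ℕ)

coeff : List ℕ → Lin → ℚ
coeff α = foldr (λ { (c , β) acc → if eqL α β then c + acc else acc }) 0ℚ

scale : ℚ → Lin → Lin
scale c = map (λ { (d , β) → (c * d , β) })

-- H_β with the convention H_0 = 1
Hb : List ℕ → Lin
Hb β = (1ℚ , dropZeros β) ∷ []

-- product in NSym (free associative: concatenation of words)
mulN : Lin → Lin → Lin
mulN L L' = concatMap (λ { (c , a) → map (λ { (d , b) → (c * d , a ++ b) }) L' }) L

-- product in QSym: M_a M_b = Σ over quasi-shuffles (overlapping shuffles)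
qsh : List ℕ → List ℕ → List (List ℕ)
qsh [] b = b ∷ []
qsh (x ∷ a) [] = (x ∷ a) ∷ []
qsh (x ∷ a) (y ∷ b) =
  map (x ∷_) (qsh a (y ∷ b)) ++ map (y ∷_) (qsh (x ∷ a) b) ++ map ((x ℕ.+ y) ∷_) (qsh a b)

mulQ : Lin → Lin → Lin
mulQ F G = concatMap (λ { (c , a) → concatMap (λ { (d , b) → map (λ γ → (c * d , γ)) (qsh a b) }) G }) F

-- the pairing ⟨H_α , M_β⟩ = δ_{αβ}, extended bilinearly
pair : Lin → Lin → ℚ
pair h f = foldr (λ { (c , a) acc → c * coeff a f + acc }) 0ℚ h

-- F_{1^i} = M_{1^i}
F1 : ℕ → Lin
F1 i = (1ℚ , replicate i 1) ∷ []

-- F_{1^i}^⊥ (H_β) = Σ_{γ ⊨ |β| - i} ⟨H_β , F_{1^i} M_γ⟩ H_γ   (0 if i > |β|)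
perpB : ℕ → List ℕ → Lin
perpB i β = if i ≤ᵇ sumℕ β
  then map (λ γ → (pair (Hb β) (mulQ (F1 i) ((1ℚ , γ) ∷ [])) , γ)) (comps (sumℕ β ∸ i))
  else []

-- 𝔹_m (H_β) = Σ_{i ≥ 0} (-1)^i H_{m+i} F_{1^i}^⊥(H_β); terms with i > |β| vanish
Bb : ℕ → List ℕ → Lin
Bb m β = concatMap (λ i → scale (signPow i) (mulN (Hb (m ℕ.+ i ∷ [])) (perpB i β))) (upTo (suc (sumℕ β)))

𝔹 : ℕ → Lin → Lin
𝔹 m h = concatMap (λ { (c , β) → scale c (Bb m β) }) h

𝔖 : List ℕ → Lin
𝔖 α = foldr 𝔹 ((1ℚ , []) ∷ []) α

δ : List ℕ → List ℕ → ℚ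
δ α β = if eqL α β then 1ℚ else 0ℚ

decreasing : List ℕ → Bool
decreasing [] = true
decreasing (x ∷ []) = true
decreasing (x ∷ y ∷ xs) = (y ≤ᵇ x) ∧ decreasing (y ∷ xs)

isPartition : List ℕ → Bool
isPartition la = allB (map (λ x → 0 <ᵇ x) la) ∧ decreasing la

words : ℕ → ℕ → List (List ℕ)
words m zero = [] ∷ []
words m (suc len) = concatMap (λ x → map (x ∷_) (words m len)) (map suc (upTo m))

fillings : ℕ → List ℕ → List (List (List ℕ))
fillings m [] = [] ∷ []
fillings m (r ∷ la) = concatMap (λ row → map (row ∷_) (fillings m la)) (words m r)

rowWeak : List ℕ → Bool
rowWeak (x ∷ y ∷ xs) = (x ≤ᵇ y) ∧ rowWeak (y ∷ xs)
rowWeak _ = true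

strictBelow : List ℕ → List ℕ → Bool
strictBelow _ [] = true
strictBelow [] (_ ∷ _) = false
strictBelow (x ∷ xs) (y ∷ ys) = (x <ᵇ y) ∧ strictBelow xs ys

colStrict : List (List ℕ) → Bool
colStrict (r ∷ r' ∷ rs) = strictBelow r r' ∧ colStrict (r' ∷ rs)
colStrict _ = true

occurrences : ℕ → List ℕ → ℕ
occurrences j w = countTrue (map (λ x → x ≡ᵇ j) w)

concatL : List (List ℕ) → List ℕ
concatL = foldr _++_ []

hasContent : List ℕ → List (List ℕ) → Bool
hasContent α T = allB (map (λ j → occurrences (suc j) (concatL T) ≡ᵇ nth α j) (upTo (length α)))

isSSYT : List ℕ → List (List ℕ) → Bool
isSSYT α T = allB (map rowWeak T) ∧ colStrict T ∧ hasContent α T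

-- number of SSYT of shape la and content α = coefficient of x^α in s_la
ssytCount : List ℕ → List ℕ → ℕ
ssytCount la α = countTrue (map (isSSYT α) (fillings (length α) la))

-- s_la ∈ Sym ⊆ QSym in the M-basis: s_la = Σ_{α ⊨ |la|} (#SSYT(la, α)) M_α
schur : List ℕ → Lin
schur la = map (λ α → ((+ ssytCount la α) / 1 , α)) (comps (sumℕ la))

words0 : ℕ → ℕ → List (List ℕ)
words0 m zero = [] ∷ []
words0 m (suc len) = concatMap (λ x → map (x ∷_) (words0 m len)) (upTo m)

notIn : ℕ → List ℕ → Bool
notIn x ys = allB (map (λ y → not (x ≡ᵇ y)) ys)

distinct : List ℕ → Bool
distinct [] = true
distinct (x ∷ xs) = notIn x xs ∧ distinct xs

filterB : {A : Set} → (A → Bool) → List A → List A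
filterB p [] = []
filterB p (x ∷ xs) = if p x then x ∷ filterB p xs else filterB p xs

perms : ℕ → List (List ℕ)
perms k = filterB distinct (words0 k k)

inversions : List ℕ → ℕ
inversions [] = 0
inversions (x ∷ xs) = countTrue (map (λ y → y <ᵇ x) xs) ℕ.+ inversions xs

sgn : List ℕ → ℚ
sgn σ = signPow (inversions σ)

-- with 0-indexing, part i is la[σ i] + i - σ i  (same as 1-indexed formula)
admissibleFrom : ℕ → List ℕ → List ℕ → Bool
admissibleFrom i la [] = true
admissibleFrom i la (s ∷ σ) = (s <ᵇ nth la s ℕ.+ i) ∧ admissibleFrom (suc i) la σ

partsFrom : ℕ → List ℕ → List ℕ → List ℕ
partsFrom i la [] = []
partsFrom i la (s ∷ σ) = (nth la s ℕ.+ i ∸ s) ∷ partsFrom (suc i) la σ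

dualElt : (List ℕ → List ℕ → ℚ) → ℕ → List ℕ → Lin
dualElt g n β = map (λ γ → (g β γ , γ)) (comps n)

-- Σ_{σ ∈ S_k admissible} (-1)^σ 𝔖*_{(la_{σ1}+1-σ1, …)}, with 𝔖* given by g
rhs : (List ℕ → List ℕ → ℚ) → List ℕ → ℕ → Lin
rhs g la k = concatMap (λ σ → scale (sgn σ) (dualElt g (sumℕ la) (partsFrom 0 la σ)))
                       (filterB (admissibleFrom 0 la) (perms k))

module Submission where

-- Both sides are linear functionals on NSym_n (through the pairing with H_γ).  The 𝔖_α, α ⊨ n, span
-- NSym_n because 𝔖_(m,α) is H_m 𝔖_α plus words with a larger first letter, so it is enough to compare
-- values on every 𝔖_α.  The functional of s_λ is computed on bead configurations w_i = λ_i + k - i,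
-- 1 ≤ i ≤ k: h_r^⊥ moves beads down in all possible ways, and on antisymmetric functions this reduces to
-- removal of horizontal strips, which is the recursion satisfied by the number of semistandard tableaux.
-- The bead deletions D_M satisfy h_r D_M - h_(r-1) D_(M+1) = D_M h_r, which mirrors
-- F_{1^i}^⊥(H_r X) = H_r F_{1^i}^⊥(X) + H_(r-1) F_{1^(i-1)}^⊥(X); hence 𝔹_m is adjoint to the signed deletion of the
-- bead at m + k - 1, and deleting all the beads one after another produces the signed sum over permutations.

open import Defs
open import Data.Bool using (Bool; true; false; if_then_else_; _∧_; _∨_; not; T)
open import Data.Bool.Properties using (T-∧; ∧-zeroʳ; ∧-assoc; ∧-comm; ∨-zeroʳ)
open import Data.Empty using (⊥-elim)
import Data.Integer as ℤ
import Data.Integer.Properties as ℤₚ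
open import Data.List using (List; []; _∷_; _++_; _∷ʳ_; map; concatMap; length; upTo; applyUpTo; replicate)
open import Data.List.Membership.Propositional using (_∈_; lose)
open import Data.List.Membership.Propositional.Properties using (∈-concatMap⁺; ∈-map⁺; ∈-upTo⁺; ∈-upTo⁻)
open import Data.List.Properties using (≡-dec; ++-assoc; length-++; length-map; length-upTo; map-++; map-applyUpTo; map-upTo; upTo-∷ʳ)
open import Data.List.Relation.Binary.Permutation.Propositional using (_↭_; ↭-refl; ↭-sym; ↭-trans; refl; prep; swap)
open import Data.List.Relation.Binary.Permutation.Propositional.Properties using (All-resp-↭; map⁺; ↭-length)
open import Data.List.Relation.Unary.All as All using (All; []; _∷_)
import Data.List.Relation.Unary.All.Properties as Allₚ
open import Data.List.Relation.Unary.AllPairs using (AllPairs; []; _∷_)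
import Data.List.Relation.Unary.AllPairs.Properties as AllPairsₚ
open import Data.List.Relation.Unary.Any using (here; there)
open import Data.List.Reverse using (Reverse; []; _∶_∶ʳ_; reverseView)
open import Data.Nat as ℕ using (ℕ; zero; suc; _∸_; _≡ᵇ_; _<ᵇ_; _≤ᵇ_; _≤_; _<_; z≤n; s≤s)
open import Data.Nat.Induction using (<-wellFounded)
open import Data.Nat.ListAction.Properties using (sum-↭)
import Data.Nat.Properties as ℕₚ
open import Data.Product using (_×_; _,_; proj₁; proj₂)
open import Data.Rational using (ℚ; 0ℚ; 1ℚ; _+_; _*_; -_; _-_; _/_; fromℚᵘ; toℚᵘ) renaming (_≤_ to _≤ℚ_)
import Data.Rational.Properties as ℚₚ
open import Data.Rational.Solver using (module +-*-Solver)
import Data.Rational.Unnormalised as ℚᵘ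
import Data.Rational.Unnormalised.Properties as ℚᵘₚ
open import Data.Sum using (_⊎_; inj₁; inj₂)
open import Data.Unit using (tt)
open import Function using (_∘_; id; Equivalence)
open import Induction.WellFounded using (Acc; acc)
open import Relation.Binary.PropositionalEquality
open import Relation.Nullary using (¬_; yes; no)
open import Algebra.Properties.Group ℚₚ.+-0-group using (inverseˡ-unique; ∙-cancelˡ; ∙-cancelʳ)
open import Data.List.Membership.DecPropositional (≡-dec ℕ._≟_) using (_∈?_)
open ≡-Reasoning
open +-*-Solver using (solve; _:=_; _:+_; _:*_; :-_; _:-_; con)

-- Finite sums

-- Moving all beads independently makes `h` act bead by bead on lists in any order, which is what
-- its commutation with `D` needs; tableaux see only moves that keep the beads interlaced. The
-- excess moves cancel because `ψ γ` is antisymmetric. The index m + k - 1 is the place of the bead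
-- of a first row of length m among k beads. It depends on the number of beads, which `h` preserves
-- and `D` lowers by one, so functions are often compared only on lists of a given length. The i-th
-- deletion for α is at α_i + k - i, while row s has its bead at λ_s + k - s; equality means α_i =
-- λ_s + i - s, which is the formula of the theorem. Since α_i > 0, only admissible choices are met.
-- If α has fewer than k parts, the beads left over lie above position 0, because λ_s > 0, and form
-- no vacuum; if α has more, nothing is left to delete. Both values are 0.

+-interchange : ∀ a b c d → (a + b) + (c + d) ≡ (a + c) + (b + d)
+-interchange = solve 4 (λ a b c d → (a :+ b) :+ (c :+ d) := (a :+ c) :+ (b :+ d)) refl

-- The order of ℚ replaces division by 2: negation turns either inequality between x and 0 into the
-- other one.
x≡-x⇒x≡0 : ∀ x → x ≡ - x → x ≡ 0ℚ
x≡-x⇒x≡0 x eq = ℚₚ.≤-antisym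
  (helper (ℚₚ.≤-total x 0ℚ)) (helper′ (ℚₚ.≤-total x 0ℚ))
  where
  helper : x ≤ℚ 0ℚ ⊎ 0ℚ ≤ℚ x → x ≤ℚ 0ℚ
  helper (inj₁ x≤0) = x≤0
  helper (inj₂ 0≤x) = subst (_≤ℚ 0ℚ) (sym eq) (ℚₚ.neg-antimono-≤ 0≤x)
  helper′ : x ≤ℚ 0ℚ ⊎ 0ℚ ≤ℚ x → 0ℚ ≤ℚ x
  helper′ (inj₁ x≤0) = subst (0ℚ ≤ℚ_) (sym eq) (ℚₚ.neg-antimono-≤ x≤0)
  helper′ (inj₂ 0≤x) = 0≤x

x≡x+x⇒x≡0 : ∀ x → x ≡ x + x → x ≡ 0ℚ
x≡x+x⇒x≡0 x eq = ∙-cancelˡ x x 0ℚ (trans (sym eq) (sym (ℚₚ.+-identityʳ x)))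

-- Sums, `conv`, `lower`, `h`, `D`, `strips` and `tableaux` are all instances in their function
-- argument, so one notion lets them be interchanged with one another. Extensionality is a field
-- because functions that agree pointwise need not be equal; zero, negation and subtraction follow
-- from additivity alone.
record Additive {X : Set} (L : (X → ℚ) → ℚ) : Set where
  field
    ext    : ∀ {f g} → (∀ x → f x ≡ g x) → L f ≡ L g
    +-homo : ∀ f g → L (λ x → f x + g x) ≡ L f + L g

  0-homo : L (λ _ → 0ℚ) ≡ 0ℚ
  0-homo = x≡x+x⇒x≡0 _ (+-homo (λ _ → 0ℚ) (λ _ → 0ℚ))

  0-ext : ∀ {f} → (∀ x → f x ≡ 0ℚ) → L f ≡ 0ℚ
  0-ext eq = trans (ext eq) 0-homo

  neg-homo : ∀ f → L (λ x → - f x) ≡ - L f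
  neg-homo f = inverseˡ-unique _ _ (trans (sym (+-homo (λ x → - f x) f))
    (0-ext (λ x → ℚₚ.+-inverseˡ (f x))))

  sub-homo : ∀ f g → L (λ x → f x - g x) ≡ L f - L g
  sub-homo f g = trans (+-homo f (λ x → - g x)) (cong (L f +_) (neg-homo g))

  signPow-homo : ∀ n f → L (λ x → signPow n * f x) ≡ signPow n * L f
  signPow-homo zero    f = trans (ext (λ x → ℚₚ.*-identityˡ (f x))) (sym (ℚₚ.*-identityˡ (L f)))
  signPow-homo (suc n) f = begin
    L (λ x → - signPow n * f x)    ≡⟨ ext (λ x → sym (ℚₚ.neg-distribˡ-* (signPow n) (f x))) ⟩
    L (λ x → - (signPow n * f x))  ≡⟨ neg-homo _ ⟩
    - L (λ x → signPow n * f x)    ≡⟨ cong -_ (signPow-homo n f) ⟩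
    - (signPow n * L f)            ≡⟨ ℚₚ.neg-distribˡ-* (signPow n) (L f) ⟩
    - signPow n * L f              ∎

open Additive public

when : Bool → ℚ → ℚ
when b q = if b then q else 0ℚ

when-additive : ∀ {X} b {L : (X → ℚ) → ℚ} → Additive L → Additive (λ f → when b (L f))
when-additive false L⁺ .ext eq      = refl
when-additive false L⁺ .+-homo f g = refl
when-additive true  L⁺              = L⁺

at-additive : ∀ {X : Set} (x : X) → Additive (λ f → f x)
at-additive x .ext eq      = eq x
at-additive x .+-homo f g = refl

when-homo : ∀ {X} {L : (X → ℚ) → ℚ} → Additive L → ∀ b f →
  L (λ x → when b (f x)) ≡ when b (L f)
when-homo L⁺ false f = 0-homo L⁺
when-homo L⁺ true  f = refl

when-∧ : ∀ a b q → when (a ∧ b) q ≡ when a (when b q)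
when-∧ false b q = refl
when-∧ true  b q = refl

when-comm : ∀ a b q → when a (when b q) ≡ when b (when a q)
when-comm false false q = refl
when-comm false true  q = refl
when-comm true  false q = refl
when-comm true  true  q = refl

when-*ʳ : ∀ b p q → when b (p * q) ≡ p * when b q
when-*ʳ false p q = sym (ℚₚ.*-zeroʳ p)
when-*ʳ true  p q = refl

when-T : ∀ b {p q} → (T b → p ≡ q) → when b p ≡ when b q
when-T false eq = refl
when-T true  eq = eq _

∑ : {A : Set} → List A → (A → ℚ) → ℚ
∑ []       f = 0ℚ
∑ (x ∷ xs) f = f x + ∑ xs f

∑-additive : ∀ {A : Set} (xs : List A) → Additive (∑ xs)
∑-additive []       .ext eq      = refl
∑-additive (x ∷ xs) .ext eq      = cong₂ _+_ (eq x) (∑-additive xs .ext eq)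
∑-additive []       .+-homo f g = refl
∑-additive (x ∷ xs) .+-homo f g =
  trans (cong (f x + g x +_) (∑-additive xs .+-homo f g)) (+-interchange (f x) (g x) (∑ xs f) (∑ xs g))

∑-swap : ∀ {A X : Set} {L : (X → ℚ) → ℚ} → Additive L → (xs : List A) (F : A → X → ℚ) →
  L (λ x → ∑ xs (λ a → F a x)) ≡ ∑ xs (λ a → L (F a))
∑-swap L⁺ []       F = 0-homo L⁺
∑-swap {L = L} L⁺ (a ∷ xs) F = trans (+-homo L⁺ (F a) _) (cong (L (F a) +_) (∑-swap L⁺ xs F))

∑-++ : ∀ {A : Set} (xs ys : List A) f → ∑ (xs ++ ys) f ≡ ∑ xs f + ∑ ys f
∑-++ []       ys f = sym (ℚₚ.+-identityˡ _)
∑-++ (x ∷ xs) ys f = trans (cong (f x +_) (∑-++ xs ys f)) (sym (ℚₚ.+-assoc (f x) _ _))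

∑-map : ∀ {A B : Set} (g : A → B) xs f → ∑ (map g xs) f ≡ ∑ xs (f ∘ g)
∑-map g []       f = refl
∑-map g (x ∷ xs) f = cong (f (g x) +_) (∑-map g xs f)

∑-concatMap : ∀ {A B : Set} (g : A → List B) xs f → ∑ (concatMap g xs) f ≡ ∑ xs (λ x → ∑ (g x) f)
∑-concatMap g []       f = refl
∑-concatMap g (x ∷ xs) f = trans (∑-++ (g x) (concatMap g xs) f) (cong (∑ (g x) f +_) (∑-concatMap g xs f))

∑-cong-All : ∀ {A : Set} {xs : List A} {f g : A → ℚ} → All (λ x → f x ≡ g x) xs → ∑ xs f ≡ ∑ xs g
∑-cong-All []         = refl
∑-cong-All (eq ∷ eqs) = cong₂ _+_ eq (∑-cong-All eqs)

∑-*ˡ : ∀ {A : Set} c (xs : List A) f → ∑ xs (λ x → c * f x) ≡ c * ∑ xs f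
∑-*ˡ c []       f = sym (ℚₚ.*-zeroʳ c)
∑-*ˡ c (x ∷ xs) f = trans (cong (c * f x +_) (∑-*ˡ c xs f)) (sym (ℚₚ.*-distribˡ-+ c (f x) (∑ xs f)))

∑-filterB : ∀ {A : Set} (p : A → Bool) xs f → ∑ (filterB p xs) f ≡ ∑ xs (λ x → when (p x) (f x))
∑-filterB p []       f = refl
∑-filterB p (x ∷ xs) f with p x
... | true  = cong (f x +_) (∑-filterB p xs f)
... | false = trans (∑-filterB p xs f) (sym (ℚₚ.+-identityˡ _))

∑-upTo-suc : ∀ n f → ∑ (upTo (suc n)) f ≡ f 0 + ∑ (upTo n) (f ∘ suc)
∑-upTo-suc n f = cong (f 0 +_) (trans (cong (λ xs → ∑ xs f) (sym (map-upTo suc n))) (∑-map suc (upTo n) f))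

-- Every sum over a + b = n occurs in this form, so that no subtraction of indices is needed.
conv : ℕ → (ℕ × ℕ → ℚ) → ℚ
conv zero    f = f (0 , 0)
conv (suc n) f = f (0 , suc n) + conv n (λ (a , b) → f (suc a , b))

conv-additive : ∀ n → Additive (conv n)
conv-additive zero    .ext eq     = eq _
conv-additive (suc n) .ext eq     = cong₂ _+_ (eq _) (conv-additive n .ext (λ (a , b) → eq (suc a , b)))
conv-additive zero    .+-homo f g = refl
conv-additive (suc n) .+-homo f g =
  trans (cong (f (0 , suc n) + g (0 , suc n) +_) (conv-additive n .+-homo _ _))
        (+-interchange (f (0 , suc n)) (g (0 , suc n)) _ _)

conv-swap : ∀ {X : Set} {L : (X → ℚ) → ℚ} → Additive L → ∀ n (F : ℕ × ℕ → X → ℚ) →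
  L (λ x → conv n (λ p → F p x)) ≡ conv n (λ p → L (F p))
conv-swap L⁺ zero    F = refl
conv-swap {L = L} L⁺ (suc n) F = trans (+-homo L⁺ (F (0 , suc n)) _) (cong (L (F (0 , suc n)) +_) (conv-swap L⁺ n (λ (a , b) → F (suc a , b))))

conv-sucʳ : ∀ n f → conv (suc n) f ≡ conv n (λ (a , b) → f (a , suc b)) + f (suc n , 0)
conv-sucʳ zero    f = refl
conv-sucʳ (suc n) f = trans (cong (f (0 , suc (suc n)) +_) (conv-sucʳ n (λ (a , b) → f (suc a , b)))) (sym (ℚₚ.+-assoc (f (0 , suc (suc n))) _ _))

conv-comm : ∀ n f → conv n (λ (a , b) → f (b , a)) ≡ conv n f
conv-comm zero    f = refl
conv-comm (suc n) f = begin
  f (suc n , 0) + conv n (λ (a , b) → f (b , suc a))  ≡⟨ ℚₚ.+-comm (f (suc n , 0)) _ ⟩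
  conv n (λ (a , b) → f (b , suc a)) + f (suc n , 0)  ≡⟨ cong (_+ f (suc n , 0)) (conv-comm n (λ (a , b) → f (a , suc b))) ⟩
  conv n (λ (a , b) → f (a , suc b)) + f (suc n , 0)  ≡⟨ conv-sucʳ n f ⟨
  conv (suc n) f                                      ∎

conv-antisym : ∀ n f → (∀ a b → f (a , b) ≡ - f (b , a)) → conv n f ≡ 0ℚ
conv-antisym n f anti = x≡-x⇒x≡0 _ (begin
  conv n f                              ≡⟨ conv-additive n .ext (λ (a , b) → anti a b) ⟩
  conv n (λ (a , b) → - f (b , a))      ≡⟨ neg-homo (conv-additive n) (λ (a , b) → f (b , a)) ⟩
  - conv n (λ (a , b) → f (b , a))      ≡⟨ cong -_ (conv-comm n f) ⟩
  - conv n f                            ∎)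

conv-at-0 : ∀ n f → (∀ a b → f (a , suc b) ≡ 0ℚ) → conv n f ≡ f (n , 0)
conv-at-0 zero    f eq = refl
conv-at-0 (suc n) f eq = trans (cong₂ _+_ (eq 0 n) (conv-at-0 n _ (λ a b → eq (suc a) b))) (ℚₚ.+-identityˡ _)

conv-assoc : ∀ n (X : ℕ → ℕ → ℕ → ℚ) →
  conv n (λ (a , b) → conv b (λ (c , d) → X a c d)) ≡ conv n (λ (p , d) → conv p (λ (a , c) → X a c d))
conv-assoc zero    X = refl
conv-assoc (suc n) X = begin
  conv (suc n) (λ (c , d) → X 0 c d) + conv n (λ (a , b) → conv b (λ (c , d) → X (suc a) c d))
    ≡⟨ cong (conv (suc n) (λ (c , d) → X 0 c d) +_) (conv-assoc n (λ a → X (suc a))) ⟩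
  (X 0 0 (suc n) + conv n (λ (c , d) → X 0 (suc c) d)) + conv n (λ (p , d) → conv p (λ (a , c) → X (suc a) c d))
    ≡⟨ ℚₚ.+-assoc (X 0 0 (suc n)) _ _ ⟩
  X 0 0 (suc n) + (conv n (λ (c , d) → X 0 (suc c) d) + conv n (λ (p , d) → conv p (λ (a , c) → X (suc a) c d)))
    ≡⟨ cong (X 0 0 (suc n) +_) (conv-additive n .+-homo _ _) ⟨
  X 0 0 (suc n) + conv n (λ (p , d) → X 0 (suc p) d + conv p (λ (a , c) → X (suc a) c d))  ∎

conv-exchange : ∀ n (X : ℕ → ℕ → ℕ → ℚ) →
  conv n (λ (a , b) → conv b (λ (c , d) → X a c d)) ≡ conv n (λ (a , b) → conv b (λ (c , d) → X c a d))
conv-exchange n X = begin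
  conv n (λ (a , b) → conv b (λ (c , d) → X a c d))  ≡⟨ conv-assoc n X ⟩
  conv n (λ (p , d) → conv p (λ (a , c) → X a c d))  ≡⟨ conv-additive n .ext (λ (p , d) → sym (conv-comm p (λ (a , c) → X a c d))) ⟩
  conv n (λ (p , d) → conv p (λ (a , c) → X c a d))  ≡⟨ conv-assoc n (λ a c d → X c a d) ⟨
  conv n (λ (a , b) → conv b (λ (c , d) → X c a d))  ∎

-- The translate g (x - a), with value 0 for a > x instead of a truncated difference: a bead pushed
-- below 0 contributes nothing.
lower : ℕ → (ℕ → ℚ) → ℕ → ℚ
lower zero    g x       = g x
lower (suc a) g zero    = 0ℚ
lower (suc a) g (suc x) = lower a g x

lower-additive : ∀ a x → Additive (λ g → lower a g x)
lower-additive zero    x       .ext eq     = eq x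
lower-additive (suc a) zero    .ext eq     = refl
lower-additive (suc a) (suc x) .ext eq     = lower-additive a x .ext eq
lower-additive zero    x       .+-homo f g = refl
lower-additive (suc a) zero    .+-homo f g = refl
lower-additive (suc a) (suc x) .+-homo f g = lower-additive a x .+-homo f g

lower-swap : ∀ {X : Set} {L : (X → ℚ) → ℚ} → Additive L → ∀ a n (F : ℕ → X → ℚ) →
  L (λ x → lower a (λ y → F y x) n) ≡ lower a (λ y → L (F y)) n
lower-swap L⁺ zero    n       F = refl
lower-swap L⁺ (suc a) zero    F = 0-homo L⁺
lower-swap L⁺ (suc a) (suc n) F = lower-swap L⁺ a n F

lower-sucʳ : ∀ a g x → lower (suc a) g x ≡ lower a (λ y → lower 1 g y) x
lower-sucʳ zero    g zero    = refl
lower-sucʳ zero    g (suc x) = refl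
lower-sucʳ (suc a) g zero    = refl
lower-sucʳ (suc a) g (suc x) = lower-sucʳ a g x

lower-lower : ∀ a c g x → lower a (λ y → lower c g y) x ≡ lower c (λ y → lower a g y) x
lower-lower zero    c       g x       = refl
lower-lower (suc a) zero    g x       = refl
lower-lower (suc a) (suc c) g zero    = refl
lower-lower (suc a) (suc c) g (suc x) = begin
  lower a (λ y → lower (suc c) g y) x          ≡⟨ lower-additive a x .ext (lower-sucʳ c g) ⟩
  lower a (λ y → lower c (lower 1 g) y) x      ≡⟨ lower-lower a c (lower 1 g) x ⟩
  lower c (λ y → lower a (lower 1 g) y) x      ≡⟨ lower-additive c x .ext (lower-sucʳ a g) ⟨
  lower c (λ y → lower (suc a) g y) x          ∎

-- Bead configurations

-- The action of h_r^⊥ on a function of bead positions: beads move down by r steps in total,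
-- and a move below 0 gives the value 0.
h : ℕ → (List ℕ → ℚ) → List ℕ → ℚ
h r f []      = when (r ≡ᵇ 0) (f [])
h r f (x ∷ w) = conv r (λ (a , b) → lower a (λ y → h b (λ v → f (y ∷ v)) w) x)

h-additive : ∀ r w → Additive (λ f → h r f w)
h-additive r []      = when-additive (r ≡ᵇ 0) (at-additive [])
h-additive r (x ∷ w) .ext eq = conv-additive r .ext (λ (a , b) → lower-additive a x .ext (λ y →
  h-additive b w .ext (λ v → eq (y ∷ v))))
h-additive r (x ∷ w) .+-homo f g = begin
  conv r (λ (a , b) → lower a (λ y → h b (λ v → f (y ∷ v) + g (y ∷ v)) w) x)
    ≡⟨ conv-additive r .ext (λ (a , b) → trans (lower-additive a x .ext (λ y → h-additive b w .+-homo _ _))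
                                               (lower-additive a x .+-homo _ _)) ⟩
  conv r (λ (a , b) → lower a (λ y → h b (λ v → f (y ∷ v)) w) x + lower a (λ y → h b (λ v → g (y ∷ v)) w) x)
    ≡⟨ conv-additive r .+-homo _ _ ⟩
  h r f (x ∷ w) + h r g (x ∷ w)  ∎

-- The number of beads does not change under `h`. This is needed because `vacuum` and the position
-- deleted by 𝔹_m depend on that number.
h-ext-length : ∀ r w {f g} → (∀ v → length v ≡ length w → f v ≡ g v) → h r f w ≡ h r g w
h-ext-length r []      eq = cong (when (r ≡ᵇ 0)) (eq [] refl)
h-ext-length r (x ∷ w) eq = conv-additive r .ext (λ (a , b) → lower-additive a x .ext (λ y →
  h-ext-length b w (λ v len → eq (y ∷ v) (cong suc len))))

h-zero : ∀ f w → h 0 f w ≡ f w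
h-zero f []      = refl
h-zero f (x ∷ w) = h-zero (λ v → f (x ∷ v)) w

h-conv-lower : ∀ b s w x (F : ℕ → ℕ → List ℕ → ℚ) →
  h b (λ v → conv s (λ (c , d) → lower c (λ z → F d z v) x)) w ≡
  conv s (λ (c , d) → lower c (λ z → h b (F d z) w) x)
h-conv-lower b s w x F = trans (conv-swap (h-additive b w) s _)
  (conv-additive s .ext (λ (c , d) → lower-swap (h-additive b w) c x _))

h-h-∷ : ∀ r s f x w → h r (h s f) (x ∷ w) ≡
  conv r (λ (a , b) → conv s (λ (c , d) → lower a (λ y → lower c (λ z → h b (h d (λ v → f (z ∷ v))) w) y) x))
h-h-∷ r s f x w = conv-additive r .ext (λ (a , b) → trans
  (lower-additive a x .ext (λ y → h-conv-lower b s w y (λ d z → h d (λ v → f (z ∷ v)))))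
  (conv-swap (lower-additive a x) s _))

-- Each bead makes its two moves independently of the others, and translations of one bead commute.
h-comm : ∀ r s f w → h r (h s f) w ≡ h s (h r f) w
h-comm r s f []      = when-comm (r ≡ᵇ 0) (s ≡ᵇ 0) (f [])
h-comm r s f (x ∷ w) = begin
  h r (h s f) (x ∷ w)
    ≡⟨ h-h-∷ r s f x w ⟩
  conv r (λ (a , b) → conv s (λ (c , d) → lower a (λ y → lower c (λ z → h b (h d (λ v → f (z ∷ v))) w) y) x))
    ≡⟨ conv-swap (conv-additive r) s _ ⟩
  conv s (λ (c , d) → conv r (λ (a , b) → lower a (λ y → lower c (λ z → h b (h d (λ v → f (z ∷ v))) w) y) x))
    ≡⟨ conv-additive s .ext (λ (c , d) → conv-additive r .ext (λ (a , b) → trans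
         (lower-lower a c _ x)
         (lower-additive c x .ext (λ y → lower-additive a y .ext (λ z → h-comm b d _ w))))) ⟩
  conv s (λ (c , d) → conv r (λ (a , b) → lower c (λ y → lower a (λ z → h d (h b (λ v → f (z ∷ v))) w) y) x))
    ≡⟨ h-h-∷ s r f x w ⟨
  h s (h r f) (x ∷ w)  ∎

-- Laplace expansion along one row: the j-th entry, counted from 0, is split off with sign (-1)^j.
-- Iterated, it produces the signs of permutations.
sel : {X : Set} → (X × List X → ℚ) → List X → ℚ
sel f []      = 0ℚ
sel f (x ∷ w) = f (x , w) - sel (λ (y , v) → f (y , x ∷ v)) w

sub-interchange : ∀ a b c d → (a + b) - (c + d) ≡ (a - c) + (b - d)
sub-interchange = solve 4 (λ a b c d → (a :+ b) :- (c :+ d) := (a :- c) :+ (b :- d)) refl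

sel-additive : ∀ {X : Set} (w : List X) → Additive (λ f → sel f w)
sel-additive []      .ext eq      = refl
sel-additive (x ∷ w) .ext eq      = cong₂ _-_ (eq _) (sel-additive w .ext (λ (y , v) → eq (y , x ∷ v)))
sel-additive []      .+-homo f g = refl
sel-additive (x ∷ w) .+-homo f g = trans (cong (λ q → f (x , w) + g (x , w) - q) (sel-additive w .+-homo _ _))
  (sub-interchange (f (x , w)) (g (x , w)) _ _)

sel-ext-↭ : ∀ {X : Set} (w : List X) {f g} → (∀ y v → y ∷ v ↭ w → f (y , v) ≡ g (y , v)) → sel f w ≡ sel g w
sel-ext-↭ []      eq = refl
sel-ext-↭ (x ∷ w) eq = cong₂ _-_ (eq x w ↭-refl)
  (sel-ext-↭ w (λ y v p → eq y (x ∷ v) (↭-trans (swap y x ↭-refl) (prep x p))))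

-- Deletion of the bead at position M, signed by the number of beads listed before it.
D : ℕ → (List ℕ → ℚ) → List ℕ → ℚ
D M f = sel (λ (y , v) → when (y ≡ᵇ M) (f v))

D-additive : ∀ M w → Additive (λ f → D M f w)
D-additive M w .ext eq      = sel-additive w .ext (λ (y , v) → cong (when (y ≡ᵇ M)) (eq v))
D-additive M w .+-homo f g = trans
  (sel-additive w .ext (λ (y , v) → when-additive (y ≡ᵇ M) (at-additive v) .+-homo f g))
  (sel-additive w .+-homo _ _)

D-ext-length : ∀ M w {f g} → (∀ v → suc (length v) ≡ length w → f v ≡ g v) → D M f w ≡ D M g w
D-ext-length M w eq = sel-ext-↭ w (λ y v p → cong (when (y ≡ᵇ M)) (eq v (↭-length p)))

lower-when : ∀ a M q x → lower a (λ y → when (y ≡ᵇ M) q) x ≡ when (x ≡ᵇ a ℕ.+ M) q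
lower-when zero    M q x       = refl
lower-when (suc a) M q zero    = refl
lower-when (suc a) M q (suc x) = lower-when a M q x

-- A bead found at M after moving down by a started at a + M. Deleting it before the move leaves b =
-- r - a steps to the other beads, and its sign is the same because moves do not change the order of
-- listing.
h-D : ∀ r M f w → h r (D M f) w ≡ conv r (λ (a , b) → D (a ℕ.+ M) (h b f) w)
h-D r M f []      = trans (when-homo (at-additive {X = ℕ} 0) (r ≡ᵇ 0) (λ _ → 0ℚ)) (trans (when-0 (r ≡ᵇ 0)) (sym (0-homo (conv-additive r))))
  where
  when-0 : ∀ b → when b 0ℚ ≡ 0ℚ
  when-0 false = refl
  when-0 true  = refl
h-D r M f (x ∷ w) = begin
  conv r (λ (a , b) → lower a (λ y → h b (λ v → when (y ≡ᵇ M) (f v) - D M (λ u → f (y ∷ u)) v) w) x)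
    ≡⟨ conv-additive r .ext (λ (a , b) → lower-additive a x .ext (λ y → trans
         (sub-homo (h-additive b w) _ _)
         (cong₂ _-_ (when-homo (h-additive b w) (y ≡ᵇ M) f) (h-D b M _ w)))) ⟩
  conv r (λ (a , b) → lower a (λ y → when (y ≡ᵇ M) (h b f w)
                                     - conv b (λ (c , d) → D (c ℕ.+ M) (h d (λ v → f (y ∷ v))) w)) x)
    ≡⟨ conv-additive r .ext (λ (a , b) → trans
         (sub-homo (lower-additive a x) _ _)
         (cong₂ _-_ (lower-when a M (h b f w) x) (conv-swap (lower-additive a x) b _))) ⟩
  conv r (λ (a , b) → when (x ≡ᵇ a ℕ.+ M) (h b f w)
                      - conv b (λ (c , d) → lower a (λ y → D (c ℕ.+ M) (h d (λ v → f (y ∷ v))) w) x))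
    ≡⟨ sub-homo (conv-additive r) _ _ ⟩
  conv r (λ (a , b) → when (x ≡ᵇ a ℕ.+ M) (h b f w))
  - conv r (λ (a , b) → conv b (λ (c , d) → lower a (λ y → D (c ℕ.+ M) (h d (λ v → f (y ∷ v))) w) x))
    -- The head bead moves a steps and the deleted bead c steps; exchanging the names lets both sums
    -- be indexed by the move of the deleted bead.
    ≡⟨ cong (λ q → conv r (λ (a , b) → when (x ≡ᵇ a ℕ.+ M) (h b f w)) - q)
         (conv-exchange r (λ a c d → lower a (λ y → D (c ℕ.+ M) (h d (λ v → f (y ∷ v))) w) x)) ⟩
  conv r (λ (a , b) → when (x ≡ᵇ a ℕ.+ M) (h b f w))
  - conv r (λ (a , b) → conv b (λ (c , d) → lower c (λ y → D (a ℕ.+ M) (h d (λ v → f (y ∷ v))) w) x))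
    ≡⟨ sub-homo (conv-additive r) _ _ ⟨
  conv r (λ (a , b) → when (x ≡ᵇ a ℕ.+ M) (h b f w)
                      - conv b (λ (c , d) → lower c (λ y → D (a ℕ.+ M) (h d (λ v → f (y ∷ v))) w) x))
    ≡⟨ conv-additive r .ext (λ (a , b) → cong (λ q → when (x ≡ᵇ a ℕ.+ M) (h b f w) - q) (trans
         (conv-swap (D-additive (a ℕ.+ M) w) b _)
         (conv-additive b .ext (λ (c , d) → lower-swap (D-additive (a ℕ.+ M) w) c x _)))) ⟨
  conv r (λ (a , b) → D (a ℕ.+ M) (h b f) (x ∷ w))  ∎

+-sub-cancel : ∀ a b → (a + b) - b ≡ a
+-sub-cancel = solve 2 (λ a b → (a :+ b) :- b := a) refl

-- In the expansion by `h-D`, the terms with a > 0 of the first product are exactly the terms of the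
-- second, so only a = 0 remains.
h-D-suc : ∀ r M f w → h (suc r) (D M f) w - h r (D (suc M) f) w ≡ D M (h (suc r) f) w
h-D-suc r M f w = begin
  h (suc r) (D M f) w - h r (D (suc M) f) w
    ≡⟨ cong₂ _-_ (h-D (suc r) M f w) (trans (h-D r (suc M) f w)
         (conv-additive r .ext (λ (a , b) → cong (λ N → D N (h b f) w) (ℕₚ.+-suc a M)))) ⟩
  (D M (h (suc r) f) w + conv r (λ (a , b) → D (suc a ℕ.+ M) (h b f) w))
  - conv r (λ (a , b) → D (suc a ℕ.+ M) (h b f) w)
    ≡⟨ +-sub-cancel (D M (h (suc r) f) w) _ ⟩
  D M (h (suc r) f) w  ∎

anticomm-step : ∀ p q r → p - (q - (- r)) ≡ - (q - (p - r))
anticomm-step = solve 3 (λ p q r → p :- (q :- (:- r)) := :- (q :- (p :- r))) refl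

-- Of two beads, the one listed later counts the other exactly when it is deleted first, so
-- reversing the order of deletion changes one sign. These are the relations of fermionic
-- annihilation operators.
D-anticomm : ∀ A B f w → D A (D B f) w ≡ - D B (D A f) w
D-anticomm A B f []      = refl
D-anticomm A B f (x ∷ w) = begin
  D A (D B f) (x ∷ w)
    ≡⟨ D-D-∷ A B ⟩
  when (x ≡ᵇ A) (D B f w) - (when (x ≡ᵇ B) (D A f w) - D A (D B (λ v → f (x ∷ v))) w)
    ≡⟨ cong (λ q → when (x ≡ᵇ A) (D B f w) - (when (x ≡ᵇ B) (D A f w) - q)) (D-anticomm A B (λ v → f (x ∷ v)) w) ⟩
  when (x ≡ᵇ A) (D B f w) - (when (x ≡ᵇ B) (D A f w) - - D B (D A (λ v → f (x ∷ v))) w)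
    ≡⟨ anticomm-step (when (x ≡ᵇ A) (D B f w)) (when (x ≡ᵇ B) (D A f w)) _ ⟩
  - (when (x ≡ᵇ B) (D A f w) - (when (x ≡ᵇ A) (D B f w) - D B (D A (λ v → f (x ∷ v))) w))
    ≡⟨ cong -_ (D-D-∷ B A) ⟨
  - D B (D A f) (x ∷ w)  ∎
  where
  D-D-∷ : ∀ A B → D A (D B f) (x ∷ w) ≡
    when (x ≡ᵇ A) (D B f w) - (when (x ≡ᵇ B) (D A f w) - D A (D B (λ v → f (x ∷ v))) w)
  D-D-∷ A B = cong (λ q → when (x ≡ᵇ A) (D B f w) - q) (trans (sub-homo (D-additive A w) _ _)
    (cong (_- D A (D B (λ v → f (x ∷ v))) w) (when-homo (D-additive A w) (x ≡ᵇ B) f)))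

-- The highest bead is deleted first, which gives the decreasing list k - 1, ..., 0 the value 1.
vacuumOf : ℕ → List ℕ → ℚ
vacuumOf zero    []      = 1ℚ
vacuumOf zero    (_ ∷ _) = 0ℚ
vacuumOf (suc k) w       = D k (vacuumOf k) w

-- The sign of w as an arrangement of 0, …, k-1, and 0 when w is not one.
vacuum : List ℕ → ℚ
vacuum w = vacuumOf (length w) w

vacuum-D : ∀ k w → length w ≡ suc k → vacuum w ≡ D k vacuum w
vacuum-D k w len = trans (cong (λ n → vacuumOf n w) len)
  (D-ext-length k w (λ v len′ → cong (λ n → vacuumOf n v) (ℕₚ.suc-injective (trans (sym len) (sym len′)))))

-- For n > 0, writing vacuum = D_n vacuum and using induction on the number of beads turns `h-D`
-- into a sum of D_(a+n) D_(b+n-1) vacuum over a + b = m. The terms with b > 0 cancel in pairs by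
-- anticommutation, and b = 0 is the right-hand side. In terms of beads this is h_m = s_(m): a
-- single bead has moved.
h-vacuum : ∀ n m w → length w ≡ suc n → h m vacuum w ≡ D (m ℕ.+ n) vacuum w
h-vacuum n m w len = begin
  h m vacuum w                                           ≡⟨ h-ext-length m w (λ v len′ → vacuum-D n v (trans len′ len)) ⟩
  h m (D n vacuum) w                                     ≡⟨ h-D m n vacuum w ⟩
  conv m (λ (a , b) → D (a ℕ.+ n) (h b vacuum) w)        ≡⟨ diagonal n len ⟩
  D (m ℕ.+ n) vacuum w                                   ∎
  where
  []-of : ∀ (v : List ℕ) → length v ≡ 0 → v ≡ []
  []-of [] _ = refl
  diagonal : ∀ n → length w ≡ suc n → conv m (λ (a , b) → D (a ℕ.+ n) (h b vacuum) w) ≡ D (m ℕ.+ n) vacuum w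
  diagonal zero len = trans
    (conv-at-0 m _ (λ a b → trans
      (D-ext-length (a ℕ.+ 0) w (λ v len′ → cong (h (suc b) vacuum) ([]-of v (ℕₚ.suc-injective (trans len′ len)))))
      (0-homo (D-additive (a ℕ.+ 0) w))))
    (D-additive (m ℕ.+ 0) w .ext (h-zero vacuum))
  diagonal (suc k) len = trans
    (conv-additive m .ext (λ (a , b) → D-ext-length (a ℕ.+ suc k) w (λ v len′ →
      h-vacuum k b v (ℕₚ.suc-injective (trans len′ len)))))
    (cancel m)
    where
    F : ℕ × ℕ → ℚ
    F (a , b) = D (a ℕ.+ suc k) (D (b ℕ.+ k) vacuum) w
    F-0 : ∀ m → F (m , 0) ≡ D (m ℕ.+ suc k) vacuum w
    F-0 m = D-ext-length (m ℕ.+ suc k) w (λ v len′ → sym (vacuum-D k v (ℕₚ.suc-injective (trans len′ len))))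
    cancel : ∀ m → conv m F ≡ D (m ℕ.+ suc k) vacuum w
    cancel zero    = F-0 0
    cancel (suc m) = begin
      conv (suc m) F                                          ≡⟨ conv-sucʳ m F ⟩
      conv m (λ (a , b) → F (a , suc b)) + F (suc m , 0)      ≡⟨ cong (_+ F (suc m , 0)) (conv-antisym m _ (λ a b →
          trans (D-anticomm (a ℕ.+ suc k) (suc b ℕ.+ k) vacuum w)
            (cong₂ (λ p q → - D p (D q vacuum) w) (sym (ℕₚ.+-suc b k)) (ℕₚ.+-suc a k)))) ⟩
      0ℚ + F (suc m , 0)                                      ≡⟨ ℚₚ.+-identityˡ _ ⟩
      F (suc m , 0)                                           ≡⟨ F-0 (suc m) ⟩
      D (suc m ℕ.+ suc k) vacuum w                            ∎

-- At `beads la` this is the Kostka number ⟨H_γ, s_la⟩, by `ssytCount-ψ`. It is defined on all lists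
-- of beads because moves lead to lists that belong to no partition.
ψ : List ℕ → List ℕ → ℚ
ψ []      = vacuum
ψ (r ∷ γ) = h r (ψ γ)

-- H_0 = 1
cons⁰ : ℕ → List ℕ → List ℕ
cons⁰ zero    γ = γ
cons⁰ (suc r) γ = suc r ∷ γ

ψ-cons⁰ : ∀ r γ w → ψ (cons⁰ r γ) w ≡ h r (ψ γ) w
ψ-cons⁰ zero    γ w = sym (h-zero (ψ γ) w)
ψ-cons⁰ (suc r) γ w = refl

-- Σ_i (-1)^i g(i , F_{1^i}^⊥ H_β), from F_{1^i}^⊥ (H_r X) = H_r F_{1^i}^⊥ X + H_{r-1} F_{1^{i-1}}^⊥ X.
alternating : List ℕ → (ℕ × List ℕ → ℚ) → ℚ
alternating []      g = g (0 , [])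
alternating (r ∷ β) g = alternating β (λ (i , γ) → g (i , r ∷ γ))
                        - alternating β (λ (i , γ) → g (suc i , cons⁰ (ℕ.pred r) γ))

alternating-ext : ∀ β {f g} → (∀ p → f p ≡ g p) → alternating β f ≡ alternating β g
alternating-ext []      eq = eq _
alternating-ext (r ∷ β) eq = cong₂ _-_ (alternating-ext β (λ _ → eq _)) (alternating-ext β (λ _ → eq _))

alternating-swap : ∀ {X : Set} {L : (X → ℚ) → ℚ} → Additive L → ∀ β (F : ℕ × List ℕ → X → ℚ) →
  L (λ x → alternating β (λ p → F p x)) ≡ alternating β (λ p → L (F p))
alternating-swap L⁺ []      F = refl
alternating-swap L⁺ (r ∷ β) F = trans (sub-homo L⁺ _ _) (cong₂ _-_ (alternating-swap L⁺ β _) (alternating-swap L⁺ β _))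

-- The base case is `h-vacuum`. For a letter r + 1 of β, `h-comm` brings the letter to the outside,
-- and by induction the two halves of `alternating` become h_(r+1) D_M and h_r D_(M+1): the second
-- half raises i by one, hence also the deleted position. `h-D-suc` combines them.
bernstein : ∀ β → All (0 <_) β → ∀ m w →
  alternating β (λ (i , γ) → h (suc m ℕ.+ i) (ψ γ) w) ≡ D (suc m ℕ.+ ℕ.pred (length w)) (ψ β) w
-- Without beads both sides are 0 because the index of 𝔹 is positive; h_0 would give `vacuum []`,
-- which is 1.
bernstein [] [] m []      = refl
bernstein [] [] m (x ∷ w) = trans (h-vacuum (length w) (suc m ℕ.+ 0) (x ∷ w) refl)
  (cong (λ n → D (n ℕ.+ length w) vacuum (x ∷ w)) (ℕₚ.+-identityʳ (suc m)))
bernstein (suc r ∷ β) (_ ∷ β⁺) m w = begin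
  alternating β (λ (i , γ) → h (suc m ℕ.+ i) (h (suc r) (ψ γ)) w)
  - alternating β (λ (i , γ) → h (suc m ℕ.+ suc i) (ψ (cons⁰ r γ)) w)
    ≡⟨ cong₂ _-_
         (trans (alternating-ext β (λ (i , γ) → h-comm (suc m ℕ.+ i) (suc r) (ψ γ) w)) (extract m (suc r)))
         (trans (alternating-ext β (λ (i , γ) → trans
             (h-additive _ w .ext (ψ-cons⁰ r γ))
             (trans (cong (λ n → h n (h r (ψ γ)) w) (ℕₚ.+-suc (suc m) i)) (h-comm (suc (suc m) ℕ.+ i) r (ψ γ) w))))
           (extract (suc m) r)) ⟩
  h (suc r) (D (suc m ℕ.+ k) (ψ β)) w - h r (D (suc (suc m ℕ.+ k)) (ψ β)) w
    ≡⟨ h-D-suc r (suc m ℕ.+ k) (ψ β) w ⟩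
  D (suc m ℕ.+ k) (h (suc r) (ψ β)) w  ∎
  where
  k = ℕ.pred (length w)
  extract : ∀ m r → alternating β (λ (i , γ) → h r (h (suc m ℕ.+ i) (ψ γ)) w) ≡ h r (D (suc m ℕ.+ k) (ψ β)) w
  extract m r = trans (sym (alternating-swap (h-additive r w) β (λ (i , γ) → h (suc m ℕ.+ i) (ψ γ))))
    (h-ext-length r w (λ v len → trans (bernstein β β⁺ m v)
      (cong (λ n → D (suc m ℕ.+ ℕ.pred n) (ψ β) v) len)))

-- Antisymmetric functions and horizontal strips

Antisymmetric : (List ℕ → ℚ) → Set
Antisymmetric f = ∀ u x y w → f (u ++ x ∷ y ∷ w) ≡ - f (u ++ y ∷ x ∷ w)

anti-step : ∀ p q r → p - (q - r) ≡ - (q - (p - - r))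
anti-step = solve 3 (λ p q r → p :- (q :- r) := :- (q :- (p :- (:- r)))) refl

neg-sub : ∀ p q → (- p) - (- q) ≡ - (p - q)
neg-sub = solve 2 (λ p q → (:- p) :- (:- q) := :- (p :- q)) refl

when-neg : ∀ b q → when b (- q) ≡ - when b q
when-neg false q = refl
when-neg true  q = refl

-- Exchanging x and y interchanges the two terms that delete one of them, and these have opposite
-- signs; in the other terms f itself changes sign.
D-antisym : ∀ M {f} → Antisymmetric f → Antisymmetric (D M f)
D-antisym M {f} anti [] x y w = begin
  when (x ≡ᵇ M) (f (y ∷ w)) - (when (y ≡ᵇ M) (f (x ∷ w)) - D M (λ v → f (x ∷ y ∷ v)) w)
    ≡⟨ anti-step (when (x ≡ᵇ M) (f (y ∷ w))) (when (y ≡ᵇ M) (f (x ∷ w))) _ ⟩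
  - (when (y ≡ᵇ M) (f (x ∷ w)) - (when (x ≡ᵇ M) (f (y ∷ w)) - - D M (λ v → f (x ∷ y ∷ v)) w))
    ≡⟨ cong (λ q → - (when (y ≡ᵇ M) (f (x ∷ w)) - (when (x ≡ᵇ M) (f (y ∷ w)) - q))) (trans
         (sym (neg-homo (D-additive M w) (λ v → f (x ∷ y ∷ v))))
         (D-additive M w .ext (λ v → sym (anti [] y x v)))) ⟩
  - (when (y ≡ᵇ M) (f (x ∷ w)) - (when (x ≡ᵇ M) (f (y ∷ w)) - D M (λ v → f (y ∷ x ∷ v)) w))  ∎
D-antisym M {f} anti (z ∷ u) x y w = trans
  (cong₂ _-_ (trans (cong (when (z ≡ᵇ M)) (anti u x y w)) (when-neg (z ≡ᵇ M) _))
             (D-antisym M (λ u → anti (z ∷ u)) u x y w))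
  (neg-sub (when (z ≡ᵇ M) (f (u ++ y ∷ x ∷ w))) _)

vacuumOf-antisym : ∀ k → Antisymmetric (vacuumOf k)
vacuumOf-antisym zero    []      x y w = refl
vacuumOf-antisym zero    (z ∷ u) x y w = refl
vacuumOf-antisym (suc k)               = D-antisym k (vacuumOf-antisym k)

vacuum-antisym : Antisymmetric vacuum
vacuum-antisym u x y w = trans (vacuumOf-antisym (length (u ++ x ∷ y ∷ w)) u x y w)
  (cong (λ n → - vacuumOf n (u ++ y ∷ x ∷ w)) (same-length u))
  where
  same-length : ∀ u → length (u ++ x ∷ y ∷ w) ≡ length (u ++ y ∷ x ∷ w)
  same-length []      = refl
  same-length (_ ∷ u) = cong suc (same-length u)

h-∷∷ : ∀ r f x y w → h r f (x ∷ y ∷ w) ≡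
  conv r (λ (a , b) → conv b (λ (c , d) → lower a (λ x′ → lower c (λ y′ → h d (λ v → f (x′ ∷ y′ ∷ v)) w) y) x))
h-∷∷ r f x y w = conv-additive r .ext (λ (a , b) → conv-swap (lower-additive a x) b _)

h-antisym : ∀ r {f} → Antisymmetric f → Antisymmetric (h r f)
h-antisym r {f} anti [] x y w = begin
  h r f (x ∷ y ∷ w)
    ≡⟨ h-∷∷ r f x y w ⟩
  conv r (λ (a , b) → conv b (λ (c , d) → lower a (λ x′ → lower c (λ y′ → h d (λ v → f (x′ ∷ y′ ∷ v)) w) y) x))
    ≡⟨ conv-exchange r _ ⟩
  conv r (λ (a , b) → conv b (λ (c , d) → lower c (λ x′ → lower a (λ y′ → h d (λ v → f (x′ ∷ y′ ∷ v)) w) y) x))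
    ≡⟨ conv-additive r .ext (λ (a , b) → trans
         (conv-additive b .ext (λ (c , d) → trans
           (lower-swap (lower-additive c x) a y _)
           (trans
             (lower-additive a y .ext (λ y′ → trans
               (lower-additive c x .ext (λ x′ → trans
                 (h-additive d w .ext (anti [] x′ y′))
                 (neg-homo (h-additive d w) _)))
               (neg-homo (lower-additive c x) _)))
             (neg-homo (lower-additive a y) _))))
         (neg-homo (conv-additive b) _)) ⟩
  conv r (λ (a , b) → - conv b (λ (c , d) → lower a (λ y′ → lower c (λ x′ → h d (λ v → f (y′ ∷ x′ ∷ v)) w) x) y))
    ≡⟨ neg-homo (conv-additive r) _ ⟩
  - conv r (λ (a , b) → conv b (λ (c , d) → lower a (λ y′ → lower c (λ x′ → h d (λ v → f (y′ ∷ x′ ∷ v)) w) x) y))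
    ≡⟨ cong -_ (h-∷∷ r f y x w) ⟨
  - h r f (y ∷ x ∷ w)  ∎
h-antisym r {f} anti (z ∷ u) x y w = trans
  (conv-additive r .ext (λ (a , b) → trans
    (lower-additive a z .ext (λ z′ → h-antisym b (λ u → anti (z′ ∷ u)) u x y w))
    (neg-homo (lower-additive a z) _)))
  (neg-homo (conv-additive r) _)

ψ-antisym : ∀ γ → Antisymmetric (ψ γ)
ψ-antisym []      = vacuum-antisym
ψ-antisym (r ∷ γ) = h-antisym r (ψ-antisym γ)

beads : List ℕ → List ℕ
beads []       = []
beads (x ∷ la) = (x ℕ.+ length la) ∷ beads la

-- Sum over the μ such that la/μ is a horizontal strip of size r, row by row: la₂ ≤ μ₁ ≤ la₁, ...
strips : ℕ → (List ℕ → ℚ) → List ℕ → ℚ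
strips r f []       = when (r ≡ᵇ 0) (f [])
strips r f (x ∷ la) = conv r (λ (a , b) →
  lower a (λ e → strips b (λ μ → f ((nth la 0 ℕ.+ e) ∷ μ)) la) (x ∸ nth la 0))

strips-additive : ∀ r la → Additive (λ f → strips r f la)
strips-additive r []       = when-additive (r ≡ᵇ 0) (at-additive [])
strips-additive r (x ∷ la) .ext eq = conv-additive r .ext (λ (a , b) → lower-additive a _ .ext (λ y →
  strips-additive b la .ext (λ v → eq _)))
strips-additive r (x ∷ la) .+-homo f g = trans
  (conv-additive r .ext (λ (a , b) → trans
    (lower-additive a _ .ext (λ y → strips-additive b la .+-homo _ _)) (lower-additive a (x ∸ nth la 0) .+-homo _ _)))
  (conv-additive r .+-homo _ _)

lower-ext-≤ : ∀ a x {f g} → (∀ y → y ≤ x → f y ≡ g y) → lower a f x ≡ lower a g x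
lower-ext-≤ zero    x       eq = eq x ℕₚ.≤-refl
lower-ext-≤ (suc a) zero    eq = refl
lower-ext-≤ (suc a) (suc x) eq = lower-ext-≤ a x (λ y y≤x → eq y (ℕₚ.m≤n⇒m≤1+n y≤x))

decreasing-∷ : ∀ x la → nth la 0 ≤ x → T (decreasing la) → T (decreasing (x ∷ la))
decreasing-∷ x []       _   _ = tt
decreasing-∷ x (y ∷ la) y≤x d = Equivalence.from T-∧ (ℕₚ.≤⇒≤ᵇ y≤x , d)

decreasing-head : ∀ x la → T (decreasing (x ∷ la)) → nth la 0 ≤ x
decreasing-head x []       _ = z≤n
decreasing-head x (y ∷ la) d = ℕₚ.≤ᵇ⇒≤ y x (proj₁ (Equivalence.to T-∧ d))

decreasing-tail : ∀ x la → T (decreasing (x ∷ la)) → T (decreasing la)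
decreasing-tail x []       _ = tt
decreasing-tail x (y ∷ la) d = proj₂ (Equivalence.to (T-∧ {y ≤ᵇ x}) d)

-- The bound on the first part of μ is what lets the next row be put on top of μ with the result
-- still decreasing.
strips-ext : ∀ r la {f g} → T (decreasing la) →
  (∀ μ → T (decreasing μ) → length μ ≡ length la → nth μ 0 ≤ nth la 0 → f μ ≡ g μ) →
  strips r f la ≡ strips r g la
strips-ext r []       dec eq = cong (when (r ≡ᵇ 0)) (eq [] tt refl z≤n)
strips-ext r (x ∷ la) dec eq = conv-additive r .ext (λ (a , b) → lower-ext-≤ a _ (λ e e≤ →
  strips-ext b la (decreasing-tail x la dec) (λ μ dec-μ len μ₁≤ →
    eq _ (decreasing-∷ _ μ (ℕₚ.≤-trans μ₁≤ (ℕₚ.m≤m+n _ e)) dec-μ) (cong suc len)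
      (subst (nth la 0 ℕ.+ e ≤_) (ℕₚ.m+[n∸m]≡n (decreasing-head x la dec)) (ℕₚ.+-monoʳ-≤ (nth la 0) e≤)))))

-- The terms in which the first bead would reach or pass the second one cancel: together they are
-- the value of an antisymmetric function at a configuration with two equal beads.
h-above : ∀ r f d y w → Antisymmetric f → h r f (d ℕ.+ suc y ∷ y ∷ w) ≡
  conv r (λ (a , b) → lower a (λ e → h b (λ v → f (e ℕ.+ suc y ∷ v)) (y ∷ w)) d)
h-above zero    f d       y w anti = refl
h-above (suc r) f zero    y w anti = cong (h (suc r) (λ v → f (suc y ∷ v)) (y ∷ w) +_)
  (trans (x≡-x⇒x≡0 (h r f (y ∷ y ∷ w)) (h-antisym r {f} anti [] y y w)) (sym (0-homo (conv-additive r))))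
h-above (suc r) f (suc d) y w anti =
  cong (h (suc r) (λ v → f (suc (d ℕ.+ suc y) ∷ v)) (y ∷ w) +_) (h-above r f d y w anti)

-- By `h-above` the first bead stops e + 1 places above the old place of the second, so the new
-- first row has length la_2 + e. Fixing it leaves a function antisymmetric in the remaining beads,
-- to which the induction applies.
h-beads : ∀ r f la → T (decreasing la) → Antisymmetric f → h r f (beads la) ≡ strips r (f ∘ beads) la
h-beads r f []           dec anti = refl
h-beads r f (x ∷ [])     dec anti = conv-additive r .ext (λ (a , b) → trans
  (cong (lower a (λ y → when (b ≡ᵇ 0) (f (y ∷ [])))) (ℕₚ.+-identityʳ x))
  (lower-additive a x .ext (λ y → cong (λ z → when (b ≡ᵇ 0) (f (z ∷ []))) (sym (ℕₚ.+-identityʳ y)))))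
h-beads r f (x ∷ y ∷ la) dec anti = begin
  h r f (x ℕ.+ suc n ∷ y ℕ.+ n ∷ beads la)
    ≡⟨ cong (λ z → h r f (z ∷ y ℕ.+ n ∷ beads la))
         (trans (cong (ℕ._+ suc n) (sym (ℕₚ.m+[n∸m]≡n (decreasing-head x (y ∷ la) dec)))) (shuffle (x ∸ y))) ⟩
  h r f ((x ∸ y) ℕ.+ suc (y ℕ.+ n) ∷ y ℕ.+ n ∷ beads la)
    ≡⟨ h-above r f (x ∸ y) (y ℕ.+ n) (beads la) anti ⟩
  conv r (λ (a , b) → lower a (λ e → h b (λ v → f (e ℕ.+ suc (y ℕ.+ n) ∷ v)) (beads (y ∷ la))) (x ∸ y))
    ≡⟨ conv-additive r .ext (λ (a , b) → lower-additive a (x ∸ y) .ext (λ e → trans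
         (h-beads b (λ v → f (e ℕ.+ suc (y ℕ.+ n) ∷ v)) (y ∷ la) dec′ (λ u → anti (e ℕ.+ suc (y ℕ.+ n) ∷ u)))
         (strips-ext b (y ∷ la) dec′ (λ μ _ len _ → cong (λ z → f (z ∷ beads μ))
           (trans (sym (shuffle e)) (cong (y ℕ.+ e ℕ.+_) (sym len))))))) ⟩
  strips r (f ∘ beads) (x ∷ y ∷ la)  ∎
  where
  n = length la
  dec′ = decreasing-tail x (y ∷ la) dec
  shuffle : ∀ e → y ℕ.+ e ℕ.+ suc n ≡ e ℕ.+ suc (y ℕ.+ n)
  shuffle e = trans (cong (ℕ._+ suc n) (ℕₚ.+-comm y e)) (trans (ℕₚ.+-assoc e y (suc n)) (cong (e ℕ.+_) (ℕₚ.+-suc y n)))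

-- Semistandard tableaux

T⇒≡true : ∀ {b} → T b → b ≡ true
T⇒≡true {true} _ = refl

¬T⇒≡false : ∀ {b} → ¬ T b → b ≡ false
¬T⇒≡false {false} _  = refl
¬T⇒≡false {true}  ¬t = ⊥-elim (¬t tt)

≡ᵇ-refl : ∀ n → (n ≡ᵇ n) ≡ true
≡ᵇ-refl n = T⇒≡true (ℕₚ.≡⇒≡ᵇ n n refl)

≢⇒≡ᵇ-false : ∀ {m n} → m ≢ n → (m ≡ᵇ n) ≡ false
≢⇒≡ᵇ-false m≢n = ¬T⇒≡false (λ t → m≢n (ℕₚ.≡ᵇ⇒≡ _ _ t))

≤⇒≤ᵇ-true : ∀ {m n} → m ≤ n → (m ≤ᵇ n) ≡ true
≤⇒≤ᵇ-true m≤n = T⇒≡true (ℕₚ.≤⇒≤ᵇ m≤n)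

>⇒≤ᵇ-false : ∀ {m n} → n < m → (m ≤ᵇ n) ≡ false
>⇒≤ᵇ-false n<m = ¬T⇒≡false (λ t → ℕₚ.<⇒≱ n<m (ℕₚ.≤ᵇ⇒≤ _ _ t))

<⇒<ᵇ-true : ∀ {m n} → m < n → (m <ᵇ n) ≡ true
<⇒<ᵇ-true m<n = T⇒≡true (ℕₚ.<⇒<ᵇ m<n)

≥⇒<ᵇ-false : ∀ {m n} → n ≤ m → (m <ᵇ n) ≡ false
≥⇒<ᵇ-false n≤m = ¬T⇒≡false (λ t → ℕₚ.≤⇒≯ n≤m (ℕₚ.<ᵇ⇒< _ _ t))

∑-upTo-ext : ∀ m {f g} → (∀ x → x < m → f x ≡ g x) → ∑ (upTo m) f ≡ ∑ (upTo m) g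
∑-upTo-ext m eq = ∑-cong-All (All.tabulate (λ {x} x∈ → eq x (∈-upTo⁻ x∈)))

∑-upTo-last : ∀ m f → ∑ (upTo (suc m)) f ≡ ∑ (upTo m) f + f m
∑-upTo-last m f = trans (cong (λ xs → ∑ xs f) (sym (upTo-∷ʳ m)))
  (trans (∑-++ (upTo m) (m ∷ []) f) (cong (∑ (upTo m) f +_) (ℚₚ.+-identityʳ (f m))))

suc/1 : ∀ n → ℤ.+ suc n / 1 ≡ 1ℚ + ℤ.+ n / 1
suc/1 n = ℚₚ.toℚᵘ-injective (begin≃
  toℚᵘ (fromℚᵘ (ℚᵘ.mkℚᵘ (ℤ.+ suc n) 0))                    ≈⟨ ℚₚ.toℚᵘ-fromℚᵘ _ ⟩
  ℚᵘ.mkℚᵘ (ℤ.+ suc n) 0                                     ≈⟨ ℚᵘ.*≡* (cong (λ i → i ℤ.* ℤ.+ 1) (cong (λ i → ℤ.+ 1 ℤ.+ i) (sym (ℤₚ.*-identityʳ (ℤ.+ n))))) ⟩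
  ℚᵘ.1ℚᵘ ℚᵘ.+ ℚᵘ.mkℚᵘ (ℤ.+ n) 0                              ≈⟨ ℚᵘₚ.+-congʳ ℚᵘ.1ℚᵘ (ℚₚ.toℚᵘ-fromℚᵘ (ℚᵘ.mkℚᵘ (ℤ.+ n) 0)) ⟨
  ℚᵘ.1ℚᵘ ℚᵘ.+ toℚᵘ (fromℚᵘ (ℚᵘ.mkℚᵘ (ℤ.+ n) 0))              ≈⟨ ℚₚ.toℚᵘ-homo-+ 1ℚ (ℤ.+ n / 1) ⟨
  toℚᵘ (1ℚ + ℤ.+ n / 1)                                   ∎≃)
  where
  open ℚᵘₚ.≃-Reasoning renaming (begin_ to begin≃_; _∎ to _∎≃)

countTrue/1 : ∀ {A : Set} (p : A → Bool) xs → ℤ.+ countTrue (map p xs) / 1 ≡ ∑ xs (λ x → when (p x) 1ℚ)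
countTrue/1 p []       = refl
countTrue/1 p (x ∷ xs) with p x
... | true  = trans (suc/1 (countTrue (map p xs))) (cong (1ℚ +_) (countTrue/1 p xs))
... | false = trans (countTrue/1 p xs) (sym (ℚₚ.+-identityˡ _))

∑-words : ∀ m n G → ∑ (words m (suc n)) G ≡ ∑ (upTo m) (λ x → ∑ (words m n) (λ row → G (suc x ∷ row)))
∑-words m n G = trans (∑-concatMap (λ x → map (x ∷_) (words m n)) (map suc (upTo m)) G)
  (trans (∑-map suc (upTo m) _) (∑-additive (upTo m) .ext (λ x → ∑-map (suc x ∷_) (words m n) G)))

IsWord : ℕ → ℕ → List ℕ → Set
IsWord m n row = length row ≡ n × All (_≤ m) row

words-IsWord : ∀ m n → All (IsWord m n) (words m n)
words-IsWord m zero    = (refl , []) ∷ []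
words-IsWord m (suc n) = Allₚ.concat⁺ (Allₚ.map⁺ (Allₚ.map⁺ (All.tabulate (λ {x} x∈ →
  Allₚ.map⁺ (All.map (λ (len , ≤m) → cong suc len , ∈-upTo⁻ x∈ ∷ ≤m) (words-IsWord m n))))))

∑-words-ext : ∀ m n {F G} → (∀ row → IsWord m n row → F row ≡ G row) → ∑ (words m n) F ≡ ∑ (words m n) G
∑-words-ext m n eq = ∑-cong-All (All.map (λ {row} w → eq row w) (words-IsWord m n))

≤head : ℕ → List ℕ → Bool
≤head x []      = true
≤head x (y ∷ _) = x ≤ᵇ y

rowWeak-∷ : ∀ x row → rowWeak (x ∷ row) ≡ ≤head x row ∧ rowWeak row
rowWeak-∷ x []        = refl
rowWeak-∷ x (_ ∷ row) = refl

when-0ℚ : ∀ b → when b 0ℚ ≡ 0ℚ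
when-0ℚ false = refl
when-0ℚ true  = refl

-- A weakly increasing row with letters at most m + 1 is, in exactly one way, such a row with
-- letters at most m followed by a copies of m + 1.
∑-weakRows : ∀ m n G → ∑ (words (suc m) n) (λ row → when (rowWeak row) (G row)) ≡
  conv n (λ (a , b) → ∑ (words m b) (λ row → when (rowWeak row) (G (row ++ replicate a (suc m)))))
∑-weakRows m zero    G = refl
∑-weakRows m (suc n) G = begin
  ∑ (words (suc m) (suc n)) (λ row → when (rowWeak row) (G row))
    ≡⟨ ∑-words (suc m) n _ ⟩
  ∑ (upTo (suc m)) (λ x → ∑ (words (suc m) n) (λ row → when (rowWeak (suc x ∷ row)) (G (suc x ∷ row))))
    ≡⟨ ∑-additive (upTo (suc m)) .ext (λ x → trans
         (∑-additive (words (suc m) n) .ext (λ row → first-letter x row))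
         (∑-weakRows m n (λ row → when (≤head (suc x) row) (G (suc x ∷ row))))) ⟩
  ∑ (upTo (suc m)) H
    ≡⟨ ∑-upTo-last m H ⟩
  ∑ (upTo m) H + H m
    ≡⟨ cong₂ _+_ small-first large-first ⟩
  conv n (λ (a , b) → K a (suc b)) + K (suc n) 0
    ≡⟨ conv-sucʳ n (λ (a , b) → K a b) ⟨
  conv (suc n) (λ (a , b) → K a b)  ∎
  where
  rest : ℕ → List ℕ
  rest a = replicate a (suc m)
  K : ℕ → ℕ → ℚ
  K a b = ∑ (words m b) (λ row → when (rowWeak row) (G (row ++ rest a)))
  E : ℕ → ℕ × ℕ → ℚ
  E x (a , b) = ∑ (words m b) (λ row → when (rowWeak row) (when (≤head (suc x) (row ++ rest a)) (G (suc x ∷ row ++ rest a))))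
  H : ℕ → ℚ
  H x = conv n (E x)
  first-letter : ∀ x row → when (rowWeak (suc x ∷ row)) (G (suc x ∷ row)) ≡
    when (rowWeak row) (when (≤head (suc x) row) (G (suc x ∷ row)))
  first-letter x row = trans (cong (λ b → when b (G (suc x ∷ row))) (rowWeak-∷ (suc x) row))
    (trans (when-∧ (≤head (suc x) row) (rowWeak row) _) (when-comm (≤head (suc x) row) (rowWeak row) _))
  ≤head-rest : ∀ x → x < suc m → ∀ row a → ≤head (suc x) (row ++ rest a) ≡ ≤head (suc x) row
  ≤head-rest x x≤m []      zero    = refl
  ≤head-rest x x≤m []      (suc a) = ≤⇒≤ᵇ-true x≤m
  ≤head-rest x x≤m (_ ∷ _) a       = refl
  small-first : ∑ (upTo m) H ≡ conv n (λ (a , b) → K a (suc b))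
  small-first = trans
    (conv-swap (∑-additive (upTo m)) n (λ p x → E x p))
    (conv-additive n .ext (λ (a , b) → trans
      (∑-upTo-ext m (λ x x<m → ∑-additive (words m b) .ext (λ row → trans
        (cong (λ t → when (rowWeak row) (when t (G (suc x ∷ row ++ rest a)))) (≤head-rest x (ℕₚ.m<n⇒m<1+n x<m) row a))
        (trans (when-comm (rowWeak row) (≤head (suc x) row) _)
          (trans (sym (when-∧ (≤head (suc x) row) (rowWeak row) _))
            (cong (λ t → when t (G (suc x ∷ row ++ rest a))) (sym (rowWeak-∷ (suc x) row))))))))
      (sym (∑-words m b _))))
  -- After a first letter m + 1 any smaller letter would be a descent, so only the row made of
  -- copies of m + 1 remains.
  large-first : H m ≡ K (suc n) 0
  large-first = trans
    (conv-at-0 n (E m) (λ a b → trans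
      (∑-words-ext m (suc b) (λ { (y ∷ row) (_ , y≤m ∷ _) → trans
        (cong (λ t → when (rowWeak (y ∷ row)) (when t (G (suc m ∷ (y ∷ row) ++ rest a)))) (>⇒≤ᵇ-false (s≤s y≤m)))
        (when-0ℚ (rowWeak (y ∷ row))) }))
      (0-homo (∑-additive (words m (suc b))))))
    (cong (λ t → when t (G (suc m ∷ rest n)) + 0ℚ) (≤head-rest m ℕₚ.≤-refl [] n))

-- Sum of F over the reading words of the semistandard tableaux of shape la with entries ≤ m
-- whose first row satisfies A.
tableaux : ℕ → (List ℕ → Bool) → List ℕ → (List ℕ → ℚ) → ℚ
tableaux m A []       F = F []
tableaux m A (x ∷ la) F = ∑ (words m x) (λ row →
  when (rowWeak row) (when (A row) (tableaux m (strictBelow row) la (λ v → F (row ++ v)))))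

tableaux-additive : ∀ m A la → Additive (tableaux m A la)
tableaux-additive m A []       = at-additive []
tableaux-additive m A (x ∷ la) .ext eq = ∑-additive (words m x) .ext (λ row →
  cong (λ q → when (rowWeak row) (when (A row) q)) (tableaux-additive m (strictBelow row) la .ext (λ v → eq _)))
tableaux-additive m A (x ∷ la) .+-homo F G = trans
  (∑-additive (words m x) .ext (λ row →
    when-additive (rowWeak row) (when-additive (A row) (tableaux-additive m (strictBelow row) la))
      .+-homo (λ v → F (row ++ v)) (λ v → G (row ++ v))))
  (∑-additive (words m x) .+-homo _ _)

∑-fillings-∷ : ∀ m x la F → ∑ (fillings m (x ∷ la)) F ≡ ∑ (words m x) (λ row → ∑ (fillings m la) (λ Θ → F (row ∷ Θ)))
∑-fillings-∷ m x la F = trans (∑-concatMap (λ row → map (row ∷_) (fillings m la)) (words m x) F)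
  (∑-additive (words m x) .ext (λ row → ∑-map (row ∷_) (fillings m la) F))

when-∧-∧ : ∀ a b c d q → when ((a ∧ b) ∧ (c ∧ d)) q ≡ when a (when c (when (b ∧ d) q))
when-∧-∧ false b c d q = refl
when-∧-∧ true  b false d q = cong (λ t → when t q) (∧-zeroʳ b)
when-∧-∧ true  b true  d q = refl

∑-fillings-below : ∀ m p la F →
  ∑ (fillings m la) (λ Θ → when (allB (map rowWeak Θ) ∧ colStrict (p ∷ Θ)) (F (concatL Θ))) ≡
  tableaux m (strictBelow p) la F
∑-fillings-below m p []       F = ℚₚ.+-identityʳ (F [])
∑-fillings-below m p (x ∷ la) F = trans (∑-fillings-∷ m x la _) (∑-additive (words m x) .ext (λ row → trans
  (∑-additive (fillings m la) .ext (λ Θ → when-∧-∧ (rowWeak row) (allB (map rowWeak Θ)) (strictBelow p row) (colStrict (row ∷ Θ)) _))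
  (trans (when-homo (∑-additive (fillings m la)) (rowWeak row) _)
    (cong (when (rowWeak row)) (trans (when-homo (∑-additive (fillings m la)) (strictBelow p row) _)
      (cong (when (strictBelow p row)) (∑-fillings-below m row la (λ v → F (row ++ v)))))))))

∑-fillings : ∀ m la F →
  ∑ (fillings m la) (λ Θ → when (allB (map rowWeak Θ) ∧ colStrict Θ) (F (concatL Θ))) ≡
  tableaux m (λ _ → true) la F
∑-fillings m []       F = ℚₚ.+-identityʳ (F [])
∑-fillings m (x ∷ la) F = trans (∑-fillings-∷ m x la _) (∑-additive (words m x) .ext (λ row → trans
  (∑-additive (fillings m la) .ext (λ Θ → when-∧-∧ (rowWeak row) (allB (map rowWeak Θ)) true (colStrict (row ∷ Θ)) _))
  (trans (when-homo (∑-additive (fillings m la)) (rowWeak row) _)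
    (cong (when (rowWeak row)) (∑-fillings-below m row la (λ v → F (row ++ v)))))))

-- By the bound every letter of the lower row stands under a letter at most m of the upper row, so
-- the copies of m + 1 below satisfy the column condition automatically. This provides the relation
-- between `A` and `A′` in `tableaux-strips` for the next row.
strictBelow-rest : ∀ m p a₀ row a → All (_≤ m) p → length row ℕ.+ a ≤ length p →
  strictBelow (p ++ replicate a₀ (suc m)) (row ++ replicate a (suc m)) ≡ strictBelow p row
strictBelow-rest m p       a₀ []        zero    _          _       = refl
strictBelow-rest m (x ∷ p) a₀ []        (suc a) (x≤m ∷ ≤m) (s≤s l) =
  cong₂ _∧_ (<⇒<ᵇ-true (s≤s x≤m)) (strictBelow-rest m p a₀ [] a ≤m l)
strictBelow-rest m (x ∷ p) a₀ (y ∷ row) a       (_ ∷ ≤m)   (s≤s l) =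
  cong ((x <ᵇ y) ∧_) (strictBelow-rest m p a₀ row a ≤m l)

-- If the lower row reaches beyond the letters at most m of the upper one, a letter at most m + 1
-- stands under m + 1 or under nothing. This forces μ_1 ≥ la_2, the horizontal strip condition.
strictBelow-long : ∀ m p a₀ row → All (_≤ suc m) row → length p < length row →
  strictBelow (p ++ replicate a₀ (suc m)) row ≡ false
strictBelow-long m []      zero     (y ∷ row) _           _       = refl
strictBelow-long m []      (suc a₀) (y ∷ row) (y≤m ∷ _)   _       =
  cong (_∧ strictBelow (replicate a₀ (suc m)) row) (≥⇒<ᵇ-false y≤m)
strictBelow-long m (x ∷ p) a₀       (y ∷ row) (_ ∷ ≤m)    (s≤s l) =
  trans (cong ((x <ᵇ y) ∧_) (strictBelow-long m p a₀ row ≤m l)) (∧-zeroʳ (x <ᵇ y))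

occurrences-++ : ∀ j u v → occurrences j (u ++ v) ≡ occurrences j u ℕ.+ occurrences j v
occurrences-++ j []      v = refl
occurrences-++ j (x ∷ u) v with x ≡ᵇ j
... | true  = cong suc (occurrences-++ j u v)
... | false = occurrences-++ j u v

occurrences-small : ∀ {m} u → All (_≤ m) u → occurrences (suc m) u ≡ 0
occurrences-small     []      []         = refl
occurrences-small {m} (x ∷ u) (x≤m ∷ ≤m) rewrite ≢⇒≡ᵇ-false {x} {suc m} (λ { refl → ℕₚ.1+n≰n x≤m }) =
  occurrences-small u ≤m

occurrences-replicate : ∀ a x → occurrences x (replicate a x) ≡ a
occurrences-replicate zero    x = refl
occurrences-replicate (suc a) x rewrite ≡ᵇ-refl x = cong suc (occurrences-replicate a x)

occurrences-replicate-≢ : ∀ a {j x} → x ≢ j → occurrences j (replicate a x) ≡ 0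
occurrences-replicate-≢ zero    x≢j = refl
occurrences-replicate-≢ (suc a) x≢j rewrite ≢⇒≡ᵇ-false x≢j = occurrences-replicate-≢ a x≢j

when-+ : ∀ a n r q → when (a ℕ.+ n ≡ᵇ r) q ≡ lower a (λ r′ → when (n ≡ᵇ r′) q) r
when-+ zero    n r       q = refl
when-+ (suc a) n zero    q = refl
when-+ (suc a) n (suc r) q = when-+ a n r q

-- Both sides sum g (r - a) (x - a) over a ≤ min(x, r). The left one is organised by the length of
-- the first row, the right one by the number of cells to remove.
conv-lower-transpose : ∀ x r (g : ℕ → ℕ → ℚ) →
  conv x (λ (a , b) → lower a (λ c → g c b) r) ≡ conv r (λ (a , c) → lower a (λ b → g c b) x)
conv-lower-transpose zero    zero    g = refl
conv-lower-transpose zero    (suc r) g = sym (trans (cong (g (suc r) 0 +_) (0-homo (conv-additive r))) (ℚₚ.+-identityʳ _))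
conv-lower-transpose (suc x) zero    g = trans (cong (g 0 (suc x) +_) (0-homo (conv-additive x))) (ℚₚ.+-identityʳ _)
conv-lower-transpose (suc x) (suc r) g = cong (g (suc r) (suc x) +_) (conv-lower-transpose x r g)

-- Row lengths b ≥ y are rewritten as b = y + e, the indexing of `strips`.
lower-when-≤ : ∀ a y d (g : ℕ → ℚ) →
  lower a (λ b → when (y ≤ᵇ b) (g b)) (y ℕ.+ d) ≡ lower a (λ e → g (y ℕ.+ e)) d
lower-when-≤ zero    y d       g = cong (λ t → when t (g (y ℕ.+ d))) (≤⇒≤ᵇ-true (ℕₚ.m≤m+n y d))
lower-when-≤ (suc a) zero    zero g = refl
lower-when-≤ (suc a) (suc y) zero g = trans
  (lower-ext-≤ a (y ℕ.+ 0) (λ b b≤ → cong (λ t → when t (g b))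
    (>⇒≤ᵇ-false (s≤s (subst (b ≤_) (ℕₚ.+-identityʳ y) b≤)))))
  (0-homo (lower-additive a (y ℕ.+ 0)))
lower-when-≤ (suc a) y (suc d) g = trans
  (cong (lower (suc a) (λ b → when (y ≤ᵇ b) (g b))) (ℕₚ.+-suc y d))
  (lower-when-≤ a y d g)

-- Removing the largest entry m+1 from a semistandard tableau removes a horizontal strip.
tableaux-strips : ∀ m la → T (decreasing la) → (A A′ : List ℕ → Bool) →
  (∀ a b row → a ℕ.+ b ≡ nth la 0 → IsWord m b row → A (row ++ replicate a (suc m)) ≡ A′ row) →
  (F : List ℕ → ℚ) → (∀ u a v → F (u ++ replicate a (suc m) ++ v) ≡ F (u ++ v)) → ∀ r →
  tableaux (suc m) A la (λ v → when (occurrences (suc m) v ≡ᵇ r) (F v)) ≡ strips r (λ μ → tableaux m A′ μ F) la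
tableaux-strips m []       dec A A′ A-A′ F F-inv zero    = refl
tableaux-strips m []       dec A A′ A-A′ F F-inv (suc r) = refl
tableaux-strips m (x ∷ la) dec A A′ A-A′ F F-inv r = begin
  tableaux (suc m) A (x ∷ la) (λ v → when (occurrences (suc m) v ≡ᵇ r) (F v))
    ≡⟨ ∑-weakRows m x (λ row → when (A row) (tableaux (suc m) (strictBelow row) la (G row))) ⟩
  conv x (λ (a , b) → ∑ (words m b) (λ row → when (rowWeak row)
    (when (A (row ++ rest a)) (tableaux (suc m) (strictBelow (row ++ rest a)) la (G (row ++ rest a))))))
    ≡⟨ conv-ext x (λ a b a+b≡x → trans
         (∑-words-ext m b (λ row w → cong (when (rowWeak row)) (trans
            (cong₂ when (A-A′ a b row a+b≡x w) (below a b row w))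
            (trans (when-comm (A′ row) (y ≤ᵇ b) _)
              (cong (when (y ≤ᵇ b)) (sym (when-homo (lower-additive a r) (A′ row) _)))))))
         (trans (∑-additive (words m b) .ext (λ row → when-comm (rowWeak row) (y ≤ᵇ b) _))
           (trans (when-homo (∑-additive (words m b)) (y ≤ᵇ b) _)
             (cong (when (y ≤ᵇ b)) (lower-swap (∑-when-additive b) a r (λ c row → when (A′ row) (inner c row))))))) ⟩
  conv x (λ (a , b) → when (y ≤ᵇ b) (lower a (λ c → Z c b) r))
    ≡⟨ conv-additive x .ext (λ (a , b) → sym (when-homo (lower-additive a r) (y ≤ᵇ b) _)) ⟩
  conv x (λ (a , b) → lower a (λ c → when (y ≤ᵇ b) (Z c b)) r)
    ≡⟨ conv-lower-transpose x r (λ c b → when (y ≤ᵇ b) (Z c b)) ⟩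
  conv r (λ (a , c) → lower a (λ b → when (y ≤ᵇ b) (Z c b)) x)
    ≡⟨ conv-additive r .ext (λ (a , c) → trans
         (cong (lower a (λ b → when (y ≤ᵇ b) (Z c b))) (sym (ℕₚ.m+[n∸m]≡n (decreasing-head x la dec))))
         (trans (lower-when-≤ a y (x ∸ y) (Z c))
           (lower-additive a (x ∸ y) .ext (λ e → sym (Z-strips c (y ℕ.+ e)))))) ⟩
  strips r (λ μ → tableaux m A′ μ F) (x ∷ la)  ∎
  where
  y = nth la 0
  rest : ℕ → List ℕ
  rest a = replicate a (suc m)
  G : List ℕ → List ℕ → ℚ
  G row v = when (occurrences (suc m) (row ++ v) ≡ᵇ r) (F (row ++ v))
  inner : ℕ → List ℕ → ℚ
  inner c row = strips c (λ μ → tableaux m (strictBelow row) μ (λ v → F (row ++ v))) la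
  Z : ℕ → ℕ → ℚ
  Z c b = ∑ (words m b) (λ row → when (rowWeak row) (when (A′ row) (inner c row)))
  conv-ext : ∀ n {f g : ℕ × ℕ → ℚ} → (∀ a b → a ℕ.+ b ≡ n → f (a , b) ≡ g (a , b)) → conv n f ≡ conv n g
  conv-ext zero    eq = eq 0 0 refl
  conv-ext (suc n) eq = cong₂ _+_ (eq 0 (suc n) refl) (conv-ext n (λ a b p → eq (suc a) b (cong suc p)))
  ∑-when-additive : ∀ b → Additive (λ f → ∑ (words m b) (λ row → when (rowWeak row) (f row)))
  ∑-when-additive b .ext eq = ∑-additive (words m b) .ext (λ row → cong (when (rowWeak row)) (eq row))
  ∑-when-additive b .+-homo f g = trans
    (∑-additive (words m b) .ext (λ row → when-additive (rowWeak row) (at-additive row) .+-homo f g))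
    (∑-additive (words m b) .+-homo _ _)
  Z-strips : ∀ c b → strips c (λ μ → tableaux m A′ (b ∷ μ) F) la ≡ Z c b
  Z-strips c b = trans (∑-swap (strips-additive c la) (words m b) _) (∑-additive (words m b) .ext (λ row →
    trans (when-homo (strips-additive c la) (rowWeak row) _)
      (cong (when (rowWeak row)) (when-homo (strips-additive c la) (A′ row) _))))
  below : ∀ a b row → IsWord m b row →
    tableaux (suc m) (strictBelow (row ++ rest a)) la (G (row ++ rest a)) ≡
    when (y ≤ᵇ b) (lower a (λ c → inner c row) r)
  below a b row (len , ≤m) = below′ (ℕₚ.≤-<-connex y b)
    where
    blocked : ∀ la → b < nth la 0 → ∀ H → tableaux (suc m) (strictBelow (row ++ rest a)) la H ≡ 0ℚ
    blocked (y ∷ la) b<y H = trans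
      (∑-words-ext (suc m) y (λ row′ (len′ , ≤m′) → trans
        (cong (λ t → when (rowWeak row′) (when t _))
          (strictBelow-long m row a row′ ≤m′ (subst₂ _<_ (sym len) (sym len′) b<y)))
        (when-0ℚ (rowWeak row′))))
      (0-homo (∑-additive (words (suc m) y)))
    count : ∀ v → occurrences (suc m) ((row ++ rest a) ++ v) ≡ a ℕ.+ occurrences (suc m) v
    count v = trans (occurrences-++ (suc m) (row ++ rest a) v) (cong (ℕ._+ occurrences (suc m) v)
      (trans (occurrences-++ (suc m) row (rest a))
        (cong₂ ℕ._+_ (occurrences-small row ≤m) (occurrences-replicate a (suc m)))))
    below′ : y ≤ b ⊎ b < y →
      tableaux (suc m) (strictBelow (row ++ rest a)) la (G (row ++ rest a)) ≡
      when (y ≤ᵇ b) (lower a (λ c → inner c row) r)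
    below′ (inj₂ b<y) = trans (blocked la b<y (G (row ++ rest a)))
      (cong (λ t → when t (lower a (λ c → inner c row) r)) (sym (>⇒≤ᵇ-false b<y)))
    below′ (inj₁ y≤b) = begin
      tableaux (suc m) (strictBelow (row ++ rest a)) la (G (row ++ rest a))
        ≡⟨ tableaux-additive (suc m) (strictBelow (row ++ rest a)) la .ext (λ v → trans
             (cong₂ (λ n q → when (n ≡ᵇ r) q) (count v) (trans (cong F (++-assoc row (rest a) v)) (F-inv row a v)))
             (when-+ a (occurrences (suc m) v) r (F (row ++ v)))) ⟩
      tableaux (suc m) (strictBelow (row ++ rest a)) la
        (λ v → lower a (λ c → when (occurrences (suc m) v ≡ᵇ c) (F (row ++ v))) r)
        ≡⟨ lower-swap (tableaux-additive (suc m) (strictBelow (row ++ rest a)) la) a r _ ⟩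
      lower a (λ c → tableaux (suc m) (strictBelow (row ++ rest a)) la
        (λ v → when (occurrences (suc m) v ≡ᵇ c) (F (row ++ v)))) r
        ≡⟨ lower-additive a r .ext (tableaux-strips m la (decreasing-tail x la dec)
             (strictBelow (row ++ rest a)) (strictBelow row)
             (λ a′ b′ row′ a′+b′≡y (len′ , _) → strictBelow-rest m row a row′ a′ ≤m
               (subst₂ _≤_ (trans (sym a′+b′≡y) (trans (ℕₚ.+-comm a′ b′) (cong (ℕ._+ a′) (sym len′)))) (sym len) y≤b))
             (λ v → F (row ++ v))
             (λ u a′ v → trans (cong F (sym (++-assoc row u _)))
               (trans (F-inv (row ++ u) a′ v) (cong F (++-assoc row u v))))) ⟩
      lower a (λ c → inner c row) r
        ≡⟨ cong (λ t → when t (lower a (λ c → inner c row) r)) (≤⇒≤ᵇ-true y≤b) ⟨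
      when (y ≤ᵇ b) (lower a (λ c → inner c row) r)  ∎

-- Tableaux of given content as values of ψ

content : List ℕ → List ℕ → Bool
content γ v = allB (map (λ j → occurrences (suc j) v ≡ᵇ nth γ j) (upTo (length γ)))

length-∷ʳ : ∀ (γ : List ℕ) r → length (γ ∷ʳ r) ≡ suc (length γ)
length-∷ʳ γ r = trans (length-++ γ) (ℕₚ.+-comm (length γ) 1)

nth-∷ʳ-< : ∀ γ r j → j < length γ → nth (γ ∷ʳ r) j ≡ nth γ j
nth-∷ʳ-< (x ∷ γ) r zero    _       = refl
nth-∷ʳ-< (x ∷ γ) r (suc j) (s≤s l) = nth-∷ʳ-< γ r j l

nth-∷ʳ-last : ∀ γ r → nth (γ ∷ʳ r) (length γ) ≡ r
nth-∷ʳ-last []      r = refl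
nth-∷ʳ-last (x ∷ γ) r = nth-∷ʳ-last γ r

allB-++ : ∀ u v → allB (u ++ v) ≡ allB u ∧ allB v
allB-++ []      v = refl
allB-++ (b ∷ u) v = trans (cong (b ∧_) (allB-++ u v)) (sym (∧-assoc b (allB u) (allB v)))

allB-map-ext : ∀ {A : Set} {p q : A → Bool} {xs} → All (λ x → p x ≡ q x) xs → allB (map p xs) ≡ allB (map q xs)
allB-map-ext []         = refl
allB-map-ext (eq ∷ eqs) = cong₂ _∧_ eq (allB-map-ext eqs)

allB-upTo-ext : ∀ m {p q : ℕ → Bool} → (∀ j → j < m → p j ≡ q j) → allB (map p (upTo m)) ≡ allB (map q (upTo m))
allB-upTo-ext m eq = allB-map-ext (All.tabulate (λ {j} j∈ → eq j (∈-upTo⁻ j∈)))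

content-∷ʳ : ∀ γ r v → content (γ ∷ʳ r) v ≡ content γ v ∧ (occurrences (suc (length γ)) v ≡ᵇ r)
content-∷ʳ γ r v = begin
  allB (map p (upTo (length (γ ∷ʳ r))))            ≡⟨ cong (λ n → allB (map p (upTo n))) (length-∷ʳ γ r) ⟩
  allB (map p (upTo (suc m)))                      ≡⟨ cong (λ xs → allB (map p xs)) (upTo-∷ʳ m) ⟨
  allB (map p (upTo m ∷ʳ m))                       ≡⟨ cong allB (map-++ p (upTo m) (m ∷ [])) ⟩
  allB (map p (upTo m) ++ p m ∷ [])                ≡⟨ allB-++ (map p (upTo m)) (p m ∷ []) ⟩
  allB (map p (upTo m)) ∧ (p m ∧ true)             ≡⟨ cong₂ _∧_
      (allB-upTo-ext m (λ j j<m → cong (occurrences (suc j) v ≡ᵇ_) (nth-∷ʳ-< γ r j j<m)))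
      (trans (∧-comm (p m) true) (cong (occurrences (suc m) v ≡ᵇ_) (nth-∷ʳ-last γ r))) ⟩
  content γ v ∧ (occurrences (suc m) v ≡ᵇ r)       ∎
  where
  m = length γ
  p : ℕ → Bool
  p j = occurrences (suc j) v ≡ᵇ nth (γ ∷ʳ r) j

-- In `ψ` the first letter is outermost, while a tableau first loses its largest entry, whose
-- multiplicity is the last letter. Commutativity of `h` reconciles the two orders.
ψ-∷ʳ : ∀ γ r w → ψ (γ ∷ʳ r) w ≡ h r (ψ γ) w
ψ-∷ʳ []      r w = refl
ψ-∷ʳ (s ∷ γ) r w = trans (h-additive s w .ext (ψ-∷ʳ γ r)) (h-comm s r (ψ γ) w)

-- The vacuum deletes only at positions up to `length w`, so a bead at x is never the one deleted.
vacuum-large : ∀ x w → length w < x → vacuum (x ∷ w) ≡ 0ℚ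
vacuum-large x w lt = go (length w) x w refl lt
  where
  go : ∀ n x w → length w ≡ n → n < x → vacuum (x ∷ w) ≡ 0ℚ
  go n x w len n<x = trans (vacuum-D n (x ∷ w) (cong suc len)) (cong₂ _-_
    (cong (λ t → when t (vacuum w)) (≢⇒≡ᵇ-false (λ x≡n → ℕₚ.<⇒≢ n<x (sym x≡n))))
    (rest n len n<x))
    where
    rest : ∀ n → length w ≡ n → n < x → sel (λ (y , v) → when (y ≡ᵇ n) (vacuum (x ∷ v))) w ≡ 0ℚ
    rest zero    len _   = cong (sel (λ (y , v) → when (y ≡ᵇ 0) (vacuum (x ∷ v)))) (empty w len)
      where
      empty : ∀ (w : List ℕ) → length w ≡ 0 → w ≡ []
      empty [] _ = refl
    rest (suc n) len n<x = trans
      (sel-ext-↭ w (λ y v p → trans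
        (cong (when (y ≡ᵇ suc n)) (go n x v (ℕₚ.suc-injective (trans (↭-length p) len)) (ℕₚ.<-trans (ℕₚ.n<1+n n) n<x)))
        (when-0ℚ (y ≡ᵇ suc n))))
      (0-homo (sel-additive w))

D-absent : ∀ M f w → All (_≢ M) w → D M f w ≡ 0ℚ
D-absent M f []      []        = refl
D-absent M f (x ∷ w) (x≢M ∷ ≢M) = cong₂ _-_
  (cong (λ t → when t (f w)) (≢⇒≡ᵇ-false x≢M)) (D-absent M (λ v → f (x ∷ v)) w ≢M)

length-beads : ∀ la → length (beads la) ≡ length la
length-beads []       = refl
length-beads (x ∷ la) = cong suc (length-beads la)

zeros : ∀ la → T (decreasing la) → nth la 0 ≡ 0 → All (_≡ 0) la
zeros []       _   _  = []
zeros (x ∷ la) dec eq = eq ∷ zeros la (decreasing-tail x la dec)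
  (ℕₚ.n≤0⇒n≡0 (subst (nth la 0 ≤_) eq (decreasing-head x la dec)))

beads-zeros : ∀ la → All (_≡ 0) la → All (_< length la) (beads la)
beads-zeros []       []         = []
beads-zeros (_ ∷ la) (refl ∷ z) = ℕₚ.n<1+n (length la) ∷ All.map ℕₚ.m<n⇒m<1+n (beads-zeros la z)

sub-0ℚ : ∀ x → x - 0ℚ ≡ x
sub-0ℚ = solve 1 (λ x → x :- con 0ℚ := x) refl

-- Without letters only a shape whose rows are all empty has a tableau. Its k beads are at k - 1,
-- ..., 0, with vacuum value 1; if the first row is nonempty, its bead is too high for the vacuum.
tableaux-0 : ∀ la → T (decreasing la) → ∀ A → A [] ≡ true → tableaux 0 A la (λ _ → 1ℚ) ≡ vacuum (beads la)
tableaux-0 []             dec A A[] = refl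
tableaux-0 (zero ∷ la)    dec A A[] = begin
  when (A []) (tableaux 0 (strictBelow []) la (λ _ → 1ℚ)) + 0ℚ
    ≡⟨ ℚₚ.+-identityʳ _ ⟩
  when (A []) (tableaux 0 (strictBelow []) la (λ _ → 1ℚ))
    ≡⟨ cong₂ when A[] (tableaux-0 la (decreasing-tail 0 la dec) (strictBelow []) refl) ⟩
  vacuum (beads la)
    ≡⟨ sub-0ℚ (vacuum (beads la)) ⟨
  vacuum (beads la) - 0ℚ
    ≡⟨ cong₂ _-_ (cong (λ t → when t (vacuum (beads la))) (≡ᵇ-refl n))
         (D-absent n _ (beads la) (All.map ℕₚ.<⇒≢ (beads-zeros la (zeros la (decreasing-tail 0 la dec) (ℕₚ.n≤0⇒n≡0 (decreasing-head 0 la dec)))))) ⟨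
  D n vacuum (n ∷ beads la)
    ≡⟨ vacuum-D n (n ∷ beads la) (cong suc (length-beads la)) ⟨
  vacuum (n ∷ beads la)  ∎
  where
  n = length la
tableaux-0 (suc x ∷ la) dec A A[] = sym (vacuum-large (suc x ℕ.+ length la) (beads la)
  (s≤s (subst (_≤ x ℕ.+ length la) (sym (length-beads la)) (ℕₚ.m≤n+m (length la) x))))

-- Induction on γ from the right, since the last letter counts the largest entry. Shapes may contain
-- zero rows here: a strip can empty a row, while the number of beads has to stay the same.
tableaux-ψ : ∀ {γ} → Reverse γ → ∀ la → T (decreasing la) →
  tableaux (length γ) (λ _ → true) la (λ v → when (content γ v) 1ℚ) ≡ ψ γ (beads la)
tableaux-ψ []            la dec = tableaux-0 la dec (λ _ → true) refl
tableaux-ψ (γ ∶ γʳ ∶ʳ r) la dec = begin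
  tableaux (length (γ ∷ʳ r)) (λ _ → true) la (λ v → when (content (γ ∷ʳ r) v) 1ℚ)
    ≡⟨ cong (λ n → tableaux n (λ _ → true) la (λ v → when (content (γ ∷ʳ r) v) 1ℚ)) (length-∷ʳ γ r) ⟩
  tableaux (suc m) (λ _ → true) la (λ v → when (content (γ ∷ʳ r) v) 1ℚ)
    ≡⟨ tableaux-additive (suc m) (λ _ → true) la .ext (λ v → trans
         (cong (λ t → when t 1ℚ) (trans (content-∷ʳ γ r v) (∧-comm (content γ v) _)))
         (when-∧ (occurrences (suc m) v ≡ᵇ r) (content γ v) 1ℚ)) ⟩
  tableaux (suc m) (λ _ → true) la (λ v → when (occurrences (suc m) v ≡ᵇ r) (when (content γ v) 1ℚ))
    ≡⟨ tableaux-strips m la dec (λ _ → true) (λ _ → true) (λ _ _ _ _ _ → refl) (λ v → when (content γ v) 1ℚ)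
         (λ u a v → cong (λ t → when t 1ℚ) (allB-upTo-ext m (λ j j<m → cong (_≡ᵇ nth γ j) (count u a v j j<m)))) r ⟩
  strips r (λ μ → tableaux m (λ _ → true) μ (λ v → when (content γ v) 1ℚ)) la
    ≡⟨ strips-ext r la dec (λ μ dec-μ _ _ → tableaux-ψ γʳ μ dec-μ) ⟩
  strips r (ψ γ ∘ beads) la
    ≡⟨ h-beads r (ψ γ) la dec (ψ-antisym γ) ⟨
  h r (ψ γ) (beads la)
    ≡⟨ ψ-∷ʳ γ r (beads la) ⟨
  ψ (γ ∷ʳ r) (beads la)  ∎
  where
  m = length γ
  count : ∀ u a v j → j < m → occurrences (suc j) (u ++ replicate a (suc m) ++ v) ≡ occurrences (suc j) (u ++ v)
  count u a v j j<m = trans (occurrences-++ (suc j) u _) (trans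
    (cong (occurrences (suc j) u ℕ.+_) (trans (occurrences-++ (suc j) (replicate a (suc m)) v)
      (cong (ℕ._+ occurrences (suc j) v) (occurrences-replicate-≢ a (λ { refl → ℕₚ.<-irrefl refl j<m })))))
    (sym (occurrences-++ (suc j) u v)))

ssytCount-ψ : ∀ la γ → T (decreasing la) → ℤ.+ ssytCount la γ / 1 ≡ ψ γ (beads la)
ssytCount-ψ la γ dec = begin
  ℤ.+ ssytCount la γ / 1
    ≡⟨ countTrue/1 (isSSYT γ) (fillings (length γ) la) ⟩
  ∑ (fillings (length γ) la) (λ Θ → when (isSSYT γ Θ) 1ℚ)
    ≡⟨ ∑-additive (fillings (length γ) la) .ext (λ Θ → trans
         (cong (λ t → when t 1ℚ) (sym (∧-assoc (allB (map rowWeak Θ)) (colStrict Θ) (hasContent γ Θ))))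
         (when-∧ (allB (map rowWeak Θ) ∧ colStrict Θ) (hasContent γ Θ) 1ℚ)) ⟩
  ∑ (fillings (length γ) la) (λ Θ → when (allB (map rowWeak Θ) ∧ colStrict Θ) (when (content γ (concatL Θ)) 1ℚ))
    ≡⟨ ∑-fillings (length γ) la (λ v → when (content γ v) 1ℚ) ⟩
  tableaux (length γ) (λ _ → true) la (λ v → when (content γ v) 1ℚ)
    ≡⟨ tableaux-ψ (reverseView γ) la dec ⟩
  ψ γ (beads la)  ∎

-- Noncommutative symmetric functions

IsComp : ℕ → List ℕ → Set
IsComp n β = All (0 <_) β × sumℕ β ≡ n

≡ᵇ-sym : ∀ m n → (m ≡ᵇ n) ≡ (n ≡ᵇ m)
≡ᵇ-sym zero    zero    = refl
≡ᵇ-sym zero    (suc n) = refl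
≡ᵇ-sym (suc m) zero    = refl
≡ᵇ-sym (suc m) (suc n) = ≡ᵇ-sym m n

eqL-sym : ∀ a b → eqL a b ≡ eqL b a
eqL-sym []      []      = refl
eqL-sym []      (_ ∷ _) = refl
eqL-sym (_ ∷ _) []      = refl
eqL-sym (x ∷ a) (y ∷ b) = cong₂ _∧_ (≡ᵇ-sym x y) (eqL-sym a b)

eqL-sound : ∀ a b → T (eqL a b) → a ≡ b
eqL-sound []      []      _ = refl
eqL-sound (x ∷ a) (y ∷ b) t = cong₂ _∷_ (ℕₚ.≡ᵇ⇒≡ x y (proj₁ t′)) (eqL-sound a b (proj₂ t′))
  where t′ = Equivalence.to (T-∧ {x ≡ᵇ y}) t

∑-upTo-δ : ∀ m x → x < m → (g : ℕ → ℚ) → ∑ (upTo m) (λ y → when (x ≡ᵇ y) (g y)) ≡ g x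
∑-upTo-δ (suc m) zero    _         g = trans (∑-upTo-suc m (λ y → when (0 ≡ᵇ y) (g y)))
  (trans (cong (g 0 +_) (0-homo (∑-additive (upTo m)))) (ℚₚ.+-identityʳ (g 0)))
∑-upTo-δ (suc m) (suc x) (s≤s x<m) g = trans (∑-upTo-suc m (λ y → when (suc x ≡ᵇ y) (g y)))
  (trans (ℚₚ.+-identityˡ _) (∑-upTo-δ m x x<m (g ∘ suc)))

compsFuel-IsComp : ∀ f n → All (IsComp n) (compsFuel f n)
compsFuel-IsComp f       zero    = ([] , refl) ∷ []
compsFuel-IsComp zero    (suc n) = []
compsFuel-IsComp (suc f) (suc n) = Allₚ.concat⁺ (Allₚ.map⁺ (Allₚ.map⁺ (All.tabulate (λ {x} x∈ →
  Allₚ.map⁺ (All.map (λ (pos , sum) → s≤s z≤n ∷ pos ,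
      cong suc (trans (cong (x ℕ.+_) sum) (ℕₚ.m+[n∸m]≡n (ℕₚ.≤-pred (∈-upTo⁻ x∈)))))
    (compsFuel-IsComp f (n ∸ x)))))))

∈-compsFuel : ∀ f n γ → IsComp n γ → n ≤ f → γ ∈ compsFuel f n
∈-compsFuel f       _ []          (_ , refl)       _         = here refl
∈-compsFuel (suc f) _ (suc x ∷ γ) (_ ∷ pos , refl) (s≤s n≤f) =
  ∈-concatMap⁺ _ (lose (∈-map⁺ suc (∈-upTo⁺ (s≤s (ℕₚ.m≤m+n x (sumℕ γ)))))
    (∈-map⁺ (suc x ∷_) (subst (λ n → γ ∈ compsFuel f n) (sym (ℕₚ.m+n∸m≡n x (sumℕ γ)))
      (∈-compsFuel f (sumℕ γ) γ (pos , refl) (ℕₚ.≤-trans (ℕₚ.m≤n+m (sumℕ γ) x) n≤f)))))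

∑-compsFuel-δ : ∀ f n γ → IsComp n γ → n ≤ f → (G : List ℕ → ℚ) → ∑ (compsFuel f n) (λ β → when (eqL γ β) (G β)) ≡ G γ
∑-compsFuel-δ f       _ []          (_ , refl)       _         G = ℚₚ.+-identityʳ (G [])
∑-compsFuel-δ (suc f) _ (suc x ∷ γ) (_ ∷ pos , refl) (s≤s n≤f) G = begin
  ∑ (compsFuel (suc f) (suc n)) (λ β → when (eqL (suc x ∷ γ) β) (G β))
    ≡⟨ trans (∑-concatMap (λ j → map (j ∷_) (compsFuel f (suc n ∸ j))) (map suc (upTo (suc n))) E)
         (∑-map suc (upTo (suc n)) (λ j → ∑ (map (j ∷_) (compsFuel f (suc n ∸ j))) E)) ⟩
  ∑ (upTo (suc n)) (λ y → ∑ (map (suc y ∷_) (compsFuel f (n ∸ y))) (λ β → when (eqL (suc x ∷ γ) β) (G β)))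
    ≡⟨ ∑-additive (upTo (suc n)) .ext (λ y → trans (∑-map (suc y ∷_) (compsFuel f (n ∸ y)) _)
         (trans (∑-additive (compsFuel f (n ∸ y)) .ext (λ β → when-∧ (x ≡ᵇ y) (eqL γ β) _))
           (when-homo (∑-additive (compsFuel f (n ∸ y))) (x ≡ᵇ y) _))) ⟩
  ∑ (upTo (suc n)) (λ y → when (x ≡ᵇ y) (∑ (compsFuel f (n ∸ y)) (λ β → when (eqL γ β) (G (suc y ∷ β)))))
    ≡⟨ ∑-upTo-δ (suc n) x (s≤s (ℕₚ.m≤m+n x (sumℕ γ))) _ ⟩
  ∑ (compsFuel f (n ∸ x)) (λ β → when (eqL γ β) (G (suc x ∷ β)))
    ≡⟨ cong (λ k → ∑ (compsFuel f k) (λ β → when (eqL γ β) (G (suc x ∷ β)))) (ℕₚ.m+n∸m≡n x (sumℕ γ)) ⟩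
  ∑ (compsFuel f (sumℕ γ)) (λ β → when (eqL γ β) (G (suc x ∷ β)))
    ≡⟨ ∑-compsFuel-δ f (sumℕ γ) γ (pos , refl) (ℕₚ.≤-trans (ℕₚ.m≤n+m (sumℕ γ) x) n≤f) (λ β → G (suc x ∷ β)) ⟩
  G (suc x ∷ γ)  ∎
  where
  n = x ℕ.+ sumℕ γ
  E : List ℕ → ℚ
  E β = when (eqL (suc x ∷ γ) β) (G β)

comps-IsComp : ∀ n → All (IsComp n) (comps n)
comps-IsComp n = compsFuel-IsComp n n

∈-comps : ∀ {n γ} → IsComp n γ → γ ∈ comps n
∈-comps {n} {γ} c = ∈-compsFuel n n γ c ℕₚ.≤-refl

∑-comps-δ : ∀ {n γ} → IsComp n γ → (G : List ℕ → ℚ) → ∑ (comps n) (λ β → when (eqL γ β) (G β)) ≡ G γ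
∑-comps-δ {n} {γ} c = ∑-compsFuel-δ n n γ c ℕₚ.≤-refl

coeff-∑ : ∀ α L → coeff α L ≡ ∑ L (λ (c , β) → when (eqL α β) c)
coeff-∑ α []            = refl
coeff-∑ α ((c , β) ∷ L) with eqL α β
... | true  = cong (c +_) (coeff-∑ α L)
... | false = trans (coeff-∑ α L) (sym (ℚₚ.+-identityˡ _))

coeff-comps : ∀ {n γ} → IsComp n γ → (G : List ℕ → ℚ) → coeff γ (map (λ β → (G β , β)) (comps n)) ≡ G γ
coeff-comps {n} {γ} c G = trans (coeff-∑ γ (map (λ β → (G β , β)) (comps n)))
  (trans (∑-map (λ β → (G β , β)) (comps n) (λ (c , β) → when (eqL γ β) c)) (∑-comps-δ c G))

coeff-outside : ∀ {n γ} L → All (λ (_ , β) → IsComp n β) L → ¬ (γ ∈ comps n) → coeff γ L ≡ 0ℚ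
coeff-outside {n} {γ} L all γ∉ = trans (coeff-∑ γ L) (trans
  (∑-cong-All (All.map (λ {(c , β)} isc → cong (λ t → when t c) (¬T⇒≡false (λ t →
    γ∉ (subst (_∈ comps n) (sym (eqL-sound γ β t)) (∈-comps isc))))) all))
  (0-homo (∑-additive L)))

-- Functionals on words in the H_r and the action of 𝔹_m

ev : Lin → (List ℕ → ℚ) → ℚ
ev L φ = ∑ L (λ (c , β) → c * φ β)

pair-ev : ∀ L F → pair L F ≡ ev L (λ α → coeff α F)
pair-ev []            F = refl
pair-ev ((c , α) ∷ L) F = cong (c * coeff α F +_) (pair-ev L F)

ev-cong-All : ∀ {P : List ℕ → Set} {L φ χ} → All (λ (_ , β) → P β) L → (∀ β → P β → φ β ≡ χ β) → ev L φ ≡ ev L χ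
ev-cong-All all eq = ∑-cong-All (All.map (λ {(c , β)} p → cong (c *_) (eq β p)) all)

ev-scale : ∀ c L φ → ev (scale c L) φ ≡ c * ev L φ
ev-scale c L φ = trans (∑-map _ L _)
  (trans (∑-additive L .ext (λ (d , β) → ℚₚ.*-assoc c d (φ β))) (∑-*ˡ c L (λ (d , β) → d * φ β)))

ev-𝔹 : ∀ m L φ → ev (𝔹 m L) φ ≡ ev L (λ β → ev (Bb m β) φ)
ev-𝔹 m L φ = trans (∑-concatMap _ L _) (∑-additive L .ext (λ (c , β) → ev-scale c (Bb m β) φ))

ev-prepend : ∀ m L φ → ev (mulN (Hb (suc m ∷ [])) L) φ ≡ ev L (λ γ → φ (suc m ∷ γ))
ev-prepend m L φ = trans (∑-++ (map _ L) [] _) (trans (ℚₚ.+-identityʳ _) (trans (∑-map _ L _)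
  (∑-additive L .ext (λ (d , β) → cong (_* φ (suc m ∷ β)) (ℚₚ.*-identityˡ d)))))

-- The words occurring in F_{1^i}^⊥ H_β: i of the letters are decreased by one.
perpWords : ℕ → List ℕ → List (List ℕ)
perpWords zero    β       = β ∷ []
perpWords (suc i) []      = []
perpWords (suc i) (r ∷ β) = map (r ∷_) (perpWords (suc i) β) ++ map (cons⁰ (ℕ.pred r)) (perpWords i β)

cons⁰-positive : ∀ r {γ} → All (0 <_) γ → All (0 <_) (cons⁰ r γ)
cons⁰-positive zero    pos = pos
cons⁰-positive (suc r) pos = s≤s z≤n ∷ pos

cons⁰-sum : ∀ r γ → sumℕ (cons⁰ r γ) ≡ r ℕ.+ sumℕ γ
cons⁰-sum zero    γ = refl
cons⁰-sum (suc r) γ = refl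

perpWords-positive : ∀ i β → All (0 <_) β → All (λ γ → All (0 <_) γ × sumℕ γ ℕ.+ i ≡ sumℕ β) (perpWords i β)
perpWords-positive zero    β           pos       = (pos , ℕₚ.+-identityʳ (sumℕ β)) ∷ []
perpWords-positive (suc i) []          pos       = []
perpWords-positive (suc i) (suc r ∷ β) (_ ∷ pos) = Allₚ.++⁺
  (Allₚ.map⁺ (All.map (λ {γ} (pos′ , sum) → s≤s z≤n ∷ pos′ ,
      trans (ℕₚ.+-assoc (suc r) (sumℕ γ) (suc i)) (cong (suc r ℕ.+_) sum)) (perpWords-positive (suc i) β pos)))
  (Allₚ.map⁺ (All.map (λ {γ} (pos′ , sum) → cons⁰-positive r pos′ ,
      trans (cong (ℕ._+ suc i) (cons⁰-sum r γ)) (trans (ℕₚ.+-suc (r ℕ.+ sumℕ γ) i)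
        (cong suc (trans (ℕₚ.+-assoc r (sumℕ γ) i) (cong (r ℕ.+_) sum))))) (perpWords-positive i β pos)))

count : List ℕ → List (List ℕ) → ℚ
count β W = ∑ W (λ δ → when (eqL β δ) 1ℚ)

count-map-∷ : ∀ r β x W → count (r ∷ β) (map (x ∷_) W) ≡ when (r ≡ᵇ x) (count β W)
count-map-∷ r β x W = trans (∑-map (x ∷_) W _)
  (trans (∑-additive W .ext (λ δ → when-∧ (r ≡ᵇ x) (eqL β δ) 1ℚ)) (when-homo (∑-additive W) (r ≡ᵇ x) _))

count-[]-map-∷ : ∀ x W → count [] (map (x ∷_) W) ≡ 0ℚ
count-[]-map-∷ x W = trans (∑-map (x ∷_) W _) (0-homo (∑-additive W))

count-++ : ∀ β V W → count β (V ++ W) ≡ count β V + count β W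
count-++ β V W = ∑-++ V W _

qsh-[] : ∀ i → qsh (replicate i 1) [] ≡ replicate i 1 ∷ []
qsh-[] zero    = refl
qsh-[] (suc i) = refl

+-assoc-swap : ∀ a b c → a + (b + c) ≡ b + (a + c)
+-assoc-swap = solve 3 (λ a b c → a :+ (b :+ c) := b :+ (a :+ c)) refl

-- The coefficient of M_β in M_{1^i} M_γ.
count-qsh : ∀ i β γ → All (0 <_) β → All (0 <_) γ → count β (qsh (replicate i 1) γ) ≡ count γ (perpWords i β)
count-qsh zero    β       γ       _ _ = cong (λ t → when t 1ℚ + 0ℚ) (eqL-sym β γ)
count-qsh (suc i) []      []      _ _ = refl
count-qsh (suc i) []      (y ∷ γ) _ _ = trans (count-++ [] (map (1 ∷_) (qsh (replicate i 1) (y ∷ γ))) _)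
  (cong₂ _+_ (count-[]-map-∷ 1 (qsh (replicate i 1) (y ∷ γ)))
    (trans (count-++ [] (map (y ∷_) (qsh (replicate (suc i) 1) γ)) _)
      (cong₂ _+_ (count-[]-map-∷ y (qsh (replicate (suc i) 1) γ)) (count-[]-map-∷ (suc y) (qsh (replicate i 1) γ)))))
count-qsh (suc i) (suc zero ∷ β) [] (_ ∷ pos) _ = begin
  count β (replicate i 1 ∷ [])                                 ≡⟨ cong (count β) (qsh-[] i) ⟨
  count β (qsh (replicate i 1) [])                             ≡⟨ count-qsh i β [] pos [] ⟩
  count [] (perpWords i β)                                     ≡⟨ ∑-map (λ γ → γ) (perpWords i β) _ ⟨
  count [] (map (λ γ → γ) (perpWords i β))                     ≡⟨ ℚₚ.+-identityˡ _ ⟨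
  0ℚ + count [] (map (λ γ → γ) (perpWords i β))                ≡⟨ cong (_+ count [] (map (λ γ → γ) (perpWords i β))) (count-[]-map-∷ 1 (perpWords (suc i) β)) ⟨
  count [] (map (1 ∷_) (perpWords (suc i) β)) + count [] (map (λ γ → γ) (perpWords i β))
    ≡⟨ count-++ [] (map (1 ∷_) (perpWords (suc i) β)) _ ⟨
  count [] (perpWords (suc i) (1 ∷ β))  ∎
count-qsh (suc i) (suc (suc r) ∷ β) [] _ _ = sym (trans
  (count-++ [] (map (suc (suc r) ∷_) (perpWords (suc i) β)) _)
  (cong₂ _+_ (count-[]-map-∷ (suc (suc r)) (perpWords (suc i) β)) (count-[]-map-∷ (suc r) (perpWords i β))))
count-qsh (suc i) (suc r ∷ β) (suc y ∷ γ) (_ ∷ pos) (_ ∷ pos′) = begin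
  count (suc r ∷ β) (qsh (replicate (suc i) 1) (suc y ∷ γ))
    ≡⟨ trans (count-++ (suc r ∷ β) (map (1 ∷_) (qsh (replicate i 1) (suc y ∷ γ))) _)
         (cong₂ _+_ (count-map-∷ (suc r) β 1 (qsh (replicate i 1) (suc y ∷ γ)))
           (trans (count-++ (suc r ∷ β) (map (suc y ∷_) (qsh (replicate (suc i) 1) γ)) _)
             (cong₂ _+_ (count-map-∷ (suc r) β (suc y) (qsh (replicate (suc i) 1) γ))
                        (count-map-∷ (suc r) β (suc (suc y)) (qsh (replicate i 1) γ))))) ⟩
  when (r ≡ᵇ 0) (count β (qsh (replicate i 1) (suc y ∷ γ))) +
    (when (r ≡ᵇ y) (count β (qsh (replicate (suc i) 1) γ)) + when (r ≡ᵇ suc y) (count β (qsh (replicate i 1) γ)))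
    ≡⟨ +-assoc-swap (when (r ≡ᵇ 0) (count β (qsh (replicate i 1) (suc y ∷ γ)))) (when (r ≡ᵇ y) (count β (qsh (replicate (suc i) 1) γ))) _ ⟩
  when (r ≡ᵇ y) (count β (qsh (replicate (suc i) 1) γ)) +
    (when (r ≡ᵇ 0) (count β (qsh (replicate i 1) (suc y ∷ γ))) + when (r ≡ᵇ suc y) (count β (qsh (replicate i 1) γ)))
    ≡⟨ cong₂ _+_
         (trans (cong₂ when (≡ᵇ-sym r y) (count-qsh (suc i) β γ pos pos′)) (sym (count-map-∷ (suc y) γ (suc r) (perpWords (suc i) β))))
         (decreased r) ⟩
  count (suc y ∷ γ) (map (suc r ∷_) (perpWords (suc i) β)) + count (suc y ∷ γ) (map (cons⁰ r) (perpWords i β))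
    ≡⟨ count-++ (suc y ∷ γ) (map (suc r ∷_) (perpWords (suc i) β)) _ ⟨
  count (suc y ∷ γ) (perpWords (suc i) (suc r ∷ β))  ∎
  where
  -- From β to γ the letter loses one unit: either it is a 1 that comes from 1^i alone and
  -- disappears, or it is y + 2, formed from a 1 and the letter y + 1 of γ.
  decreased : ∀ r → when (r ≡ᵇ 0) (count β (qsh (replicate i 1) (suc y ∷ γ))) + when (r ≡ᵇ suc y) (count β (qsh (replicate i 1) γ))
    ≡ count (suc y ∷ γ) (map (cons⁰ r) (perpWords i β))
  decreased zero    = trans (ℚₚ.+-identityʳ _) (trans (count-qsh i β (suc y ∷ γ) pos (s≤s z≤n ∷ pos′)) (sym (∑-map (λ δ → δ) (perpWords i β) _)))
  decreased (suc r) = trans (ℚₚ.+-identityˡ _) (trans (cong₂ when (≡ᵇ-sym r y) (count-qsh i β γ pos pos′)) (sym (count-map-∷ (suc y) γ (suc r) (perpWords i β))))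

dropZeros-positive : ∀ β → All (0 <_) β → dropZeros β ≡ β
dropZeros-positive []          []        = refl
dropZeros-positive (suc x ∷ β) (_ ∷ pos) = cong (suc x ∷_) (dropZeros-positive β pos)

pair-perp : ∀ i β γ → All (0 <_) β → All (0 <_) γ →
  pair (Hb β) (mulQ (F1 i) ((1ℚ , γ) ∷ [])) ≡ count γ (perpWords i β)
pair-perp i β γ pos pos′ = begin
  1ℚ * coeff (dropZeros β) product + 0ℚ
    ≡⟨ trans (ℚₚ.+-identityʳ _) (ℚₚ.*-identityˡ _) ⟩
  coeff (dropZeros β) product
    ≡⟨ cong (λ δ → coeff δ product) (dropZeros-positive β pos) ⟩
  coeff β product
    ≡⟨ coeff-∑ β product ⟩
  ∑ product (λ (c , δ) → when (eqL β δ) c)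
    ≡⟨ trans (∑-++ (W ++ []) [] _) (trans (ℚₚ.+-identityʳ _) (trans (∑-++ W [] _) (ℚₚ.+-identityʳ _))) ⟩
  ∑ W (λ (c , δ) → when (eqL β δ) c)
    ≡⟨ ∑-map (λ δ → (1ℚ * 1ℚ , δ)) (qsh (replicate i 1) γ) (λ (c , δ) → when (eqL β δ) c) ⟩
  count β (qsh (replicate i 1) γ)
    ≡⟨ count-qsh i β γ pos pos′ ⟩
  count γ (perpWords i β)  ∎
  where
  product = mulQ (F1 i) ((1ℚ , γ) ∷ [])
  W = map (λ δ → (1ℚ * 1ℚ , δ)) (qsh (replicate i 1) γ)

when-1* : ∀ b x → when b 1ℚ * x ≡ when b x
when-1* false x = ℚₚ.*-zeroˡ x
when-1* true  x = ℚₚ.*-identityˡ x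

∑-*ʳ : ∀ {A : Set} c (xs : List A) f → ∑ xs f * c ≡ ∑ xs (λ x → f x * c)
∑-*ʳ c xs f = trans (ℚₚ.*-comm (∑ xs f) c) (trans (sym (∑-*ˡ c xs f)) (∑-additive xs .ext (λ x → ℚₚ.*-comm c (f x))))

-- Each coefficient is a count over `perpWords`. After exchanging the sums, every word is left with
-- a sum over the compositions of its size, which meets it exactly once.
ev-perpB : ∀ i β φ → All (0 <_) β → i ≤ sumℕ β → ev (perpB i β) φ ≡ ∑ (perpWords i β) φ
ev-perpB i β φ pos i≤ = begin
  ev (perpB i β) φ
    ≡⟨ cong (λ t → ev (if t then L else []) φ) (≤⇒≤ᵇ-true i≤) ⟩
  ev L φ
    ≡⟨ ∑-map _ (comps n) _ ⟩
  ∑ (comps n) (λ γ → pair (Hb β) (mulQ (F1 i) ((1ℚ , γ) ∷ [])) * φ γ)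
    ≡⟨ ∑-cong-All (All.map (λ {γ} (pos′ , _) → trans (cong (_* φ γ) (pair-perp i β γ pos pos′))
         (trans (∑-*ʳ (φ γ) (perpWords i β) _) (∑-additive (perpWords i β) .ext (λ δ →
           trans (when-1* (eqL γ δ) (φ γ)) (cong (λ t → when t (φ γ)) (eqL-sym γ δ)))))) (comps-IsComp n)) ⟩
  ∑ (comps n) (λ γ → ∑ (perpWords i β) (λ δ → when (eqL δ γ) (φ γ)))
    ≡⟨ ∑-swap (∑-additive (comps n)) (perpWords i β) (λ δ γ → when (eqL δ γ) (φ γ)) ⟩
  ∑ (perpWords i β) (λ δ → ∑ (comps n) (λ γ → when (eqL δ γ) (φ γ)))
    ≡⟨ ∑-cong-All (All.map (λ {δ} (pos′ , sum) → ∑-comps-δ (pos′ , trans (sym (ℕₚ.m+n∸n≡m (sumℕ δ) i)) (cong (_∸ i) sum)) φ)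
         (perpWords-positive i β pos)) ⟩
  ∑ (perpWords i β) φ  ∎
  where
  n = sumℕ β ∸ i
  L = map (λ γ → (pair (Hb β) (mulQ (F1 i) ((1ℚ , γ) ∷ [])) , γ)) (comps n)

ev-Bb : ∀ m β φ → All (0 <_) β → ev (Bb (suc m) β) φ ≡
  ∑ (upTo (suc (sumℕ β))) (λ i → signPow i * ∑ (perpWords i β) (λ γ → φ (suc m ℕ.+ i ∷ γ)))
ev-Bb m β φ pos = trans (∑-concatMap (λ i → scale (signPow i) (mulN (Hb (suc m ℕ.+ i ∷ [])) (perpB i β)))
    (upTo (suc (sumℕ β))) (λ (c , γ) → c * φ γ))
  (∑-upTo-ext (suc (sumℕ β)) (λ i i< → trans
  (ev-scale (signPow i) (mulN (Hb (suc m ℕ.+ i ∷ [])) (perpB i β)) φ)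
  (cong (signPow i *_) (trans (ev-prepend (m ℕ.+ i) (perpB i β) φ) (ev-perpB i β _ pos (ℕₚ.≤-pred i<))))))

signed-first : ∀ x y → 1ℚ * (x + 0ℚ) + y ≡ x + y
signed-first x y = cong (_+ y) (trans (ℚₚ.*-identityˡ (x + 0ℚ)) (ℚₚ.+-identityʳ x))

-- At most `length β` letters can be decreased, so a bound beyond the length gives the whole sum. In
-- the terms that decrease the first letter i is shifted by one, which produces the minus sign of
-- `alternating`.
∑-signed-alternating : ∀ n β g → length β < n →
  ∑ (upTo n) (λ i → signPow i * ∑ (perpWords i β) (λ γ → g (i , γ))) ≡ alternating β g
∑-signed-alternating (suc n) []      g _       = trans (∑-upTo-suc n (λ i → signPow i * ∑ (perpWords i []) (λ γ → g (i , γ)))) (trans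
  (signed-first (g (0 , [])) _)
  (trans (cong (g (0 , []) +_) (trans (∑-additive (upTo n) .ext (λ i → ℚₚ.*-zeroʳ (signPow (suc i)))) (0-homo (∑-additive (upTo n)))))
    (ℚₚ.+-identityʳ _)))
∑-signed-alternating (suc n) (r ∷ β) g (s≤s l) = begin
  ∑ (upTo (suc n)) (λ i → signPow i * ∑ (perpWords i (r ∷ β)) (λ γ → g (i , γ)))
    ≡⟨ ∑-upTo-suc n (λ i → signPow i * ∑ (perpWords i (r ∷ β)) (λ γ → g (i , γ))) ⟩
  1ℚ * (g (0 , r ∷ β) + 0ℚ) + ∑ (upTo n) (λ i → signPow (suc i) * ∑ (perpWords (suc i) (r ∷ β)) (λ γ → g (suc i , γ)))
    ≡⟨ cong (1ℚ * (g (0 , r ∷ β) + 0ℚ) +_) (trans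
         (∑-additive (upTo n) .ext (λ i → trans
           (cong (signPow (suc i) *_) (trans (∑-++ (map (r ∷_) (perpWords (suc i) β)) _ _)
             (cong₂ _+_ (∑-map (r ∷_) (perpWords (suc i) β) _) (∑-map (cons⁰ (ℕ.pred r)) (perpWords i β) _))))
           (trans (ℚₚ.*-distribˡ-+ (signPow (suc i)) _ _)
             (cong (signPow (suc i) * ∑ (perpWords (suc i) β) (λ γ → g₁ (suc i , γ)) +_)
               (sym (ℚₚ.neg-distribˡ-* (signPow i) _))))))
         (sub-homo (∑-additive (upTo n)) _ _)) ⟩
  1ℚ * (g₁ (0 , β) + 0ℚ) +
    (∑ (upTo n) (λ i → signPow (suc i) * ∑ (perpWords (suc i) β) (λ γ → g₁ (suc i , γ)))
     - ∑ (upTo n) (λ i → signPow i * ∑ (perpWords i β) (λ γ → g₂ (i , γ))))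
    ≡⟨ ℚₚ.+-assoc (1ℚ * (g₁ (0 , β) + 0ℚ)) _ _ ⟨
  (1ℚ * (g₁ (0 , β) + 0ℚ) + ∑ (upTo n) (λ i → signPow (suc i) * ∑ (perpWords (suc i) β) (λ γ → g₁ (suc i , γ))))
    - ∑ (upTo n) (λ i → signPow i * ∑ (perpWords i β) (λ γ → g₂ (i , γ)))
    ≡⟨ cong (_- ∑ (upTo n) (λ i → signPow i * ∑ (perpWords i β) (λ γ → g₂ (i , γ))))
         (∑-upTo-suc n (λ i → signPow i * ∑ (perpWords i β) (λ γ → g₁ (i , γ)))) ⟨
  ∑ (upTo (suc n)) (λ i → signPow i * ∑ (perpWords i β) (λ γ → g₁ (i , γ)))
    - ∑ (upTo n) (λ i → signPow i * ∑ (perpWords i β) (λ γ → g₂ (i , γ)))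
    ≡⟨ cong₂ _-_ (∑-signed-alternating (suc n) β g₁ (ℕₚ.m<n⇒m<1+n l)) (∑-signed-alternating n β g₂ l) ⟩
  alternating (r ∷ β) g  ∎
  where
  g₁ g₂ : ℕ × List ℕ → ℚ
  g₁ (i , γ) = g (i , r ∷ γ)
  g₂ (i , γ) = g (suc i , cons⁰ (ℕ.pred r) γ)

length≤sum : ∀ β → All (0 <_) β → length β ≤ sumℕ β
length≤sum []      []          = z≤n
length≤sum (x ∷ β) (0<x ∷ pos) = ℕₚ.+-mono-≤ 0<x (length≤sum β pos)

ev-Bb-ψ : ∀ m β w → All (0 <_) β → ev (Bb (suc m) β) (λ γ → ψ γ w) ≡ D (suc m ℕ.+ ℕ.pred (length w)) (ψ β) w
ev-Bb-ψ m β w pos = trans (ev-Bb m β (λ γ → ψ γ w) pos)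
  (trans (∑-signed-alternating (suc (sumℕ β)) β _ (s≤s (length≤sum β pos))) (bernstein β pos m w))

Bb-IsComp : ∀ m β → All (λ (_ , γ) → IsComp (suc m ℕ.+ sumℕ β) γ) (Bb (suc m) β)
Bb-IsComp m β = Allₚ.concat⁺ (Allₚ.map⁺ (All.tabulate (λ {i} i∈ →
  Allₚ.map⁺ (Allₚ.++⁺ (Allₚ.map⁺ (All.map (λ {(_ , γ)} (pos , sum) → s≤s z≤n ∷ pos ,
      trans (cong (suc (m ℕ.+ i) ℕ.+_) sum) (trans (ℕₚ.+-assoc (suc m) i _)
        (cong (suc m ℕ.+_) (ℕₚ.m+[n∸m]≡n (ℕₚ.≤-pred (∈-upTo⁻ i∈)))))) (perpB-IsComp i))) []))))
  where
  perpB-IsComp : ∀ i → All (λ (_ , γ) → IsComp (sumℕ β ∸ i) γ) (perpB i β)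
  perpB-IsComp i with i ≤ᵇ sumℕ β
  ... | true  = Allₚ.map⁺ (comps-IsComp (sumℕ β ∸ i))
  ... | false = []

𝔖-IsComp : ∀ α → All (0 <_) α → All (λ (_ , β) → IsComp (sumℕ α) β) (𝔖 α)
𝔖-IsComp []          []        = ([] , refl) ∷ []
𝔖-IsComp (suc m ∷ α) (_ ∷ pos) = Allₚ.concat⁺ (Allₚ.map⁺ (All.map (λ {(_ , β)} (_ , sum) →
  Allₚ.map⁺ (All.map (λ (pos′ , sum′) → pos′ , trans sum′ (cong (suc m ℕ.+_) sum)) (Bb-IsComp m β))) (𝔖-IsComp α pos)))

sel-*ˡ : ∀ {X : Set} c (f : X × List X → ℚ) w → sel (λ p → c * f p) w ≡ c * sel f w
sel-*ˡ c f []      = sym (ℚₚ.*-zeroʳ c)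
sel-*ˡ c f (x ∷ w) = trans (cong (λ q → c * f (x , w) - q) (sel-*ˡ c _ w)) (distrib c (f (x , w)) _)
  where
  distrib : ∀ c p q → c * p - c * q ≡ c * (p - q)
  distrib = solve 3 (λ c p q → c :* p :- c :* q := c :* (p :- q)) refl

ev-D : ∀ L M (F : List ℕ → List ℕ → ℚ) w → ev L (λ β → D M (F β) w) ≡ D M (λ v → ev L (λ β → F β v)) w
ev-D L M F w = sym (trans (∑-swap (D-additive M w) L (λ (c , β) v → c * F β v)) (∑-additive L .ext (λ (c , β) →
  trans (sel-additive w .ext (λ (y , v) → when-*ʳ (y ≡ᵇ M) c (F β v))) (sel-*ˡ c _ w))))

-- The pairing of 𝔖_α with s_la when w is `beads la`. Each deletion shortens w, so the offset falls
-- by one from each part of α to the next.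
𝔇 : List ℕ → List ℕ → ℚ
𝔇 []      w = vacuum w
𝔇 (m ∷ α) w = D (m ℕ.+ ℕ.pred (length w)) (𝔇 α) w

ev-𝔖-ψ : ∀ α w → All (0 <_) α → ev (𝔖 α) (λ γ → ψ γ w) ≡ 𝔇 α w
ev-𝔖-ψ []          w []        = trans (ℚₚ.+-identityʳ _) (ℚₚ.*-identityˡ _)
ev-𝔖-ψ (suc m ∷ α) w (_ ∷ pos) = trans (ev-𝔹 (suc m) (𝔖 α) (λ γ → ψ γ w)) (trans
  (ev-cong-All (𝔖-IsComp α pos) (λ β (pos′ , _) → ev-Bb-ψ m β w pos′))
  (trans (ev-D (𝔖 α) _ ψ w) (D-additive _ w .ext (λ v → ev-𝔖-ψ α v pos))))

-- Two nested inductions: the outer one on the size n, the inner one on the size k of the word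
-- without its first letter. A larger first letter means a smaller remainder, so the words in `rest`
-- fall under the inner hypothesis. The outer one is applied to γ, of size k < n, and to the
-- functionals sending H_β to the values of φ and χ at 𝔹_(m+1) H_β.
𝔖-spans : ∀ n → Acc _<_ n → ∀ φ χ → (∀ α → IsComp n α → ev (𝔖 α) φ ≡ ev (𝔖 α) χ) → ∀ γ → IsComp n γ → φ γ ≡ χ γ
𝔖-spans _ _         φ χ eq []          (_ , refl) = trans (sym (at-[] φ)) (trans (eq [] ([] , refl)) (at-[] χ))
  where
  at-[] : ∀ φ → ev (𝔖 []) φ ≡ φ []
  at-[] φ = trans (ℚₚ.+-identityʳ _) (ℚₚ.*-identityˡ _)
𝔖-spans n (acc rec) φ χ eq (zero ∷ γ)  (() ∷ _ , _)
𝔖-spans n (acc rec) φ χ eq (suc m ∷ γ) isc = descend (sumℕ γ) (<-wellFounded _) m γ isc refl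
  where
  descend : ∀ k → Acc _<_ k → ∀ m γ → IsComp n (suc m ∷ γ) → sumℕ γ ≡ k → φ (suc m ∷ γ) ≡ χ (suc m ∷ γ)
  descend k (acc rec′) m γ (_ ∷ pos , refl) refl = begin
    φ (suc m ∷ γ)            ≡⟨ cong (λ x → φ (suc x ∷ γ)) (ℕₚ.+-identityʳ m) ⟨
    φ (suc (m ℕ.+ 0) ∷ γ)    ≡⟨ ∙-cancelʳ (rest φ) _ _ (begin
      φ (suc (m ℕ.+ 0) ∷ γ) + rest φ    ≡⟨ leading φ ⟨
      ev (Bb (suc m) γ) φ               ≡⟨ 𝔖-spans k (rec (s≤s (ℕₚ.m≤n+m k m)))
        (λ β → ev (Bb (suc m) β) φ) (λ β → ev (Bb (suc m) β) χ) eq′ γ (pos , refl) ⟩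
      ev (Bb (suc m) γ) χ               ≡⟨ leading χ ⟩
      χ (suc (m ℕ.+ 0) ∷ γ) + rest χ    ≡⟨ cong (χ (suc (m ℕ.+ 0) ∷ γ) +_) rest-≡ ⟨
      χ (suc (m ℕ.+ 0) ∷ γ) + rest φ    ∎) ⟩
    χ (suc (m ℕ.+ 0) ∷ γ)    ≡⟨ cong (λ x → χ (suc x ∷ γ)) (ℕₚ.+-identityʳ m) ⟩
    χ (suc m ∷ γ)            ∎
    where
    rest : (List ℕ → ℚ) → ℚ
    rest φ = ∑ (upTo k) (λ i → signPow (suc i) * ∑ (perpWords (suc i) γ) (λ δ → φ (suc m ℕ.+ suc i ∷ δ)))
    leading : ∀ φ → ev (Bb (suc m) γ) φ ≡ φ (suc (m ℕ.+ 0) ∷ γ) + rest φ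
    leading φ = trans (ev-Bb m γ φ pos) (trans
      (∑-upTo-suc k (λ i → signPow i * ∑ (perpWords i γ) (λ δ → φ (suc m ℕ.+ i ∷ δ)))) (signed-first (φ (suc (m ℕ.+ 0) ∷ γ)) (rest φ)))
    rest-≡ : rest φ ≡ rest χ
    rest-≡ = ∑-additive (upTo k) .ext (λ i → cong (signPow (suc i) *_) (∑-cong-All (All.map (λ {δ} (pos′ , sum) →
      descend (sumℕ δ) (rec′ (subst (suc (sumℕ δ) ≤_) sum (subst (_≤ sumℕ δ ℕ.+ suc i) (ℕₚ.+-comm (sumℕ δ) 1) (ℕₚ.+-monoʳ-≤ (sumℕ δ) (s≤s z≤n)))))
        (m ℕ.+ suc i) δ
        (s≤s z≤n ∷ pos′ , cong suc (trans (ℕₚ.+-assoc m (suc i) (sumℕ δ)) (cong (m ℕ.+_) (trans (ℕₚ.+-comm (suc i) (sumℕ δ)) sum))))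
        refl) (perpWords-positive (suc i) γ pos))))
    eq′ : ∀ α → IsComp k α → ev (𝔖 α) (λ β → ev (Bb (suc m) β) φ) ≡ ev (𝔖 α) (λ β → ev (Bb (suc m) β) χ)
    eq′ α (pos′ , sum) = trans (sym (ev-𝔹 (suc m) (𝔖 α) φ))
      (trans (eq (suc m ∷ α) (s≤s z≤n ∷ pos′ , cong (suc m ℕ.+_) sum)) (ev-𝔹 (suc m) (𝔖 α) χ))

-- Signed sums over permutations

-- When w has k entries, this is the sum of G over all arrangements of w, each with its sign
-- relative to the order of w: a complete Laplace expansion.
signedSum : ℕ → (List ℕ → ℚ) → List ℕ → ℚ
signedSum zero    G w = G []
signedSum (suc k) G w = sel (λ (y , v) → signedSum k (λ σ → G (y ∷ σ)) v) w

signedSum-additive : ∀ k w → Additive (λ G → signedSum k G w)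
signedSum-additive zero    w = at-additive []
signedSum-additive (suc k) w .ext eq = sel-additive w .ext (λ (y , v) → signedSum-additive k v .ext (λ σ → eq (y ∷ σ)))
signedSum-additive (suc k) w .+-homo F G = trans
  (sel-additive w .ext (λ (y , v) → signedSum-additive k v .+-homo (λ σ → F (y ∷ σ)) (λ σ → G (y ∷ σ))))
  (sel-additive w .+-homo _ _)

signedSum-*ˡ : ∀ c k G w → signedSum k (λ σ → c * G σ) w ≡ c * signedSum k G w
signedSum-*ˡ c zero    G w = refl
signedSum-*ˡ c (suc k) G w = trans (sel-additive w .ext (λ (y , v) → signedSum-*ˡ c k (λ σ → G (y ∷ σ)) v)) (sel-*ˡ c _ w)

signedSum-ext-↭ : ∀ k w → length w ≡ k → ∀ {F G} → (∀ σ → σ ↭ w → F σ ≡ G σ) → signedSum k F w ≡ signedSum k G w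
signedSum-ext-↭ zero    [] _   eq = eq [] ↭-refl
signedSum-ext-↭ (suc k) w  len eq = sel-ext-↭ w (λ y v p →
  signedSum-ext-↭ k v (ℕₚ.suc-injective (trans (↭-length p) len)) (λ σ q → eq (y ∷ σ) (↭-trans (prep y q) p)))

sel-map : ∀ {X Y : Set} (g : X → Y) (f : Y × List Y → ℚ) A → sel f (map g A) ≡ sel (λ (x , v) → f (g x , map g v)) A
sel-map g f []      = refl
sel-map g f (a ∷ A) = cong (λ q → f (g a , map g A) - q) (sel-map g (λ (y , v) → f (y , g a ∷ v)) A)

-- The vacuum needs a bead at 0. This disposes of compositions with fewer parts than la, for which
-- beads above 0 are left over.
vacuum-positive : ∀ n w → length w ≡ suc n → All (0 <_) w → vacuum w ≡ 0ℚ
vacuum-positive zero    w len pos = trans (vacuum-D 0 w len) (D-absent 0 vacuum w (All.map ℕₚ.>⇒≢ pos))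
vacuum-positive (suc n) w len pos = trans (vacuum-D (suc n) w len) (trans
  (sel-ext-↭ w (λ y v p → trans
    (cong (when (y ≡ᵇ suc n)) (vacuum-positive n v (ℕₚ.suc-injective (trans (↭-length p) len))
      (All.tail (All-resp-↭ (↭-sym p) pos))))
    (when-0ℚ (y ≡ᵇ suc n))))
  (0-homo (sel-additive w)))

T-ext : ∀ {a b} → (T a → T b) → (T b → T a) → a ≡ b
T-ext {true}  {true}  _ _ = refl
T-ext {true}  {false} f _ = ⊥-elim (f tt)
T-ext {false} {true}  _ g = ⊥-elim (g tt)
T-ext {false} {false} _ _ = refl

-- The bead of row s is at p + k - 1 - s with p = la_s, where k = l + i + 1.
bead-≡ᵇ : ∀ p m l i s → 0 < m → s ≤ l ℕ.+ i →
  (p ℕ.+ (l ℕ.+ i ∸ s) ≡ᵇ m ℕ.+ l) ≡ (s <ᵇ p ℕ.+ i) ∧ (m ≡ᵇ (p ℕ.+ i ∸ s))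
bead-≡ᵇ p m l i s 0<m s≤ = T-ext to from
  where
  move : (p ℕ.+ (l ℕ.+ i ∸ s)) ℕ.+ s ≡ l ℕ.+ (p ℕ.+ i)
  move = trans (ℕₚ.+-assoc p _ s) (trans (cong (p ℕ.+_) (ℕₚ.m∸n+n≡m s≤))
    (trans (sym (ℕₚ.+-assoc p l i)) (trans (cong (ℕ._+ i) (ℕₚ.+-comm p l)) (ℕₚ.+-assoc l p i))))
  move′ : (m ℕ.+ l) ℕ.+ s ≡ l ℕ.+ (m ℕ.+ s)
  move′ = trans (cong (ℕ._+ s) (ℕₚ.+-comm m l)) (ℕₚ.+-assoc l m s)
  to : T (p ℕ.+ (l ℕ.+ i ∸ s) ≡ᵇ m ℕ.+ l) → T ((s <ᵇ p ℕ.+ i) ∧ (m ≡ᵇ (p ℕ.+ i ∸ s)))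
  to t = Equivalence.from T-∧
    ( ℕₚ.<⇒<ᵇ (subst (s <_) (sym eq) (ℕₚ.m<n+m s 0<m))
    , ℕₚ.≡⇒≡ᵇ m _ (sym (trans (cong (_∸ s) eq) (ℕₚ.m+n∸n≡m m s))))
    where
    eq : p ℕ.+ i ≡ m ℕ.+ s
    eq = ℕₚ.+-cancelˡ-≡ l _ _ (trans (sym move) (trans (cong (ℕ._+ s) (ℕₚ.≡ᵇ⇒≡ _ _ t)) move′))
  from : T ((s <ᵇ p ℕ.+ i) ∧ (m ≡ᵇ (p ℕ.+ i ∸ s))) → T (p ℕ.+ (l ℕ.+ i ∸ s) ≡ᵇ m ℕ.+ l)
  from t = ℕₚ.≡⇒≡ᵇ _ _ (ℕₚ.+-cancelʳ-≡ s _ _ (trans move (trans (cong (l ℕ.+_) eq) (sym move′))))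
    where
    t′ = Equivalence.to (T-∧ {s <ᵇ p ℕ.+ i}) t
    eq : p ℕ.+ i ≡ m ℕ.+ s
    eq = sym (trans (cong (ℕ._+ s) (ℕₚ.≡ᵇ⇒≡ m _ (proj₂ t′))) (ℕₚ.m∸n+n≡m (ℕₚ.<⇒≤ (ℕₚ.<ᵇ⇒< s _ (proj₁ t′)))))

beadAt : List ℕ → ℕ → ℕ
beadAt la s = nth la s ℕ.+ (length la ∸ suc s)

beads-upTo : ∀ la → map (beadAt la) (upTo (length la)) ≡ beads la
beads-upTo []       = refl
beads-upTo (x ∷ la) = cong (x ℕ.+ length la ∷_) (trans (map-applyUpTo suc (beadAt (x ∷ la)) (length la))
  (trans (sym (map-upTo (beadAt la) (length la))) (beads-upTo la)))

matches : List ℕ → ℕ → List ℕ → List ℕ → Bool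
matches la i α σ = admissibleFrom i la σ ∧ eqL α (partsFrom i la σ)

-- A lists the rows whose beads remain and i counts the deleted ones. With l + 1 beads left,
-- deletion at m + l selects by `bead-≡ᵇ` the rows s with m = la_s + i - s, and s becomes the next
-- value of σ. Both sides expand by `sel`, so the signs agree. If α and the beads do not run out
-- together, both sides are 0.
𝔇-signedSum : ∀ la → (∀ s → s < length la → 0 < nth la s) → ∀ α → All (0 <_) α → ∀ l i A → length A ≡ l →
  l ℕ.+ i ≡ length la → All (_< length la) A →
  𝔇 α (map (beadAt la) A) ≡ signedSum l (λ σ → when (matches la i α σ) 1ℚ) A
𝔇-signedSum la la⁺ []      _ zero    i []      _   _  _  = refl
𝔇-signedSum la la⁺ []      _ (suc l) i A       len k≡ A< = trans
  (vacuum-positive l (map (beadAt la) A) (trans (length-map (beadAt la) A) len)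
    (Allₚ.map⁺ (All.map (λ {s} s< → ℕₚ.≤-trans (la⁺ s s<) (ℕₚ.m≤m+n _ _)) A<)))
  (sym (0-ext (sel-additive A) (λ (s , v) → 0-ext (signedSum-additive l v) (λ σ →
    cong (λ t → when t 1ℚ) (∧-zeroʳ (admissibleFrom i la (s ∷ σ)))))))
𝔇-signedSum la la⁺ (m ∷ α) _ zero    i []      _   _  _  = refl
𝔇-signedSum la la⁺ (m ∷ α) (0<m ∷ α⁺) (suc l) i A len k≡ A< = begin
  sel (λ (y , v) → when (y ≡ᵇ m ℕ.+ ℕ.pred (length (map (beadAt la) A))) (𝔇 α v)) (map (beadAt la) A)
    ≡⟨ sel-map (beadAt la) _ A ⟩
  sel (λ (s , v) → when (beadAt la s ≡ᵇ m ℕ.+ ℕ.pred (length (map (beadAt la) A))) (𝔇 α (map (beadAt la) v))) A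
    ≡⟨ sel-ext-↭ A (λ s v p → begin
         when (beadAt la s ≡ᵇ m ℕ.+ ℕ.pred (length (map (beadAt la) A))) (𝔇 α (map (beadAt la) v))
           ≡⟨ cong₂ when
                (trans (cong₂ (λ k n → nth la s ℕ.+ (k ∸ suc s) ≡ᵇ m ℕ.+ ℕ.pred n) (sym k≡) (trans (length-map (beadAt la) A) len))
                  (bead-≡ᵇ (nth la s) m l i s 0<m (ℕₚ.≤-pred (subst (s <_) (sym k≡) (All.head (All-resp-↭ (↭-sym p) A<))))))
                (𝔇-signedSum la la⁺ α α⁺ l (suc i) v (ℕₚ.suc-injective (trans (↭-length p) len))
                  (trans (ℕₚ.+-suc l i) k≡) (All.tail (All-resp-↭ (↭-sym p) A<))) ⟩
         when (a s ∧ c s) (signedSum l (λ σ → when (matches la (suc i) α σ) 1ℚ) v)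
           ≡⟨ when-∧ (a s) (c s) _ ⟩
         when (a s) (when (c s) (signedSum l (λ σ → when (matches la (suc i) α σ) 1ℚ) v))
           ≡⟨ cong (when (a s)) (when-homo (signedSum-additive l v) (c s) _) ⟨
         when (a s) (signedSum l (λ σ → when (c s) (when (matches la (suc i) α σ) 1ℚ)) v)
           ≡⟨ when-homo (signedSum-additive l v) (a s) _ ⟨
         signedSum l (λ σ → when (a s) (when (c s) (when (matches la (suc i) α σ) 1ℚ))) v
           ≡⟨ signedSum-additive l v .ext (λ σ → when-∧-∧ (a s) (admissibleFrom (suc i) la σ) (c s) (eqL α (partsFrom (suc i) la σ)) 1ℚ) ⟨
         signedSum l (λ σ → when (matches la i (m ∷ α) (s ∷ σ)) 1ℚ) v  ∎) ⟩
  signedSum (suc l) (λ σ → when (matches la i (m ∷ α) σ) 1ℚ) A  ∎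
  where
  a c : ℕ → Bool
  a s = s <ᵇ nth la s ℕ.+ i
  c s = m ≡ᵇ (nth la s ℕ.+ i ∸ s)

-- Permutations as repeated selection from an increasing list

elem : ℕ → List ℕ → Bool
elem s []      = false
elem s (a ∷ A) = (a ≡ᵇ s) ∨ elem s A

remove : ℕ → List ℕ → List ℕ
remove s []      = []
remove s (a ∷ A) = if a ≡ᵇ s then A else a ∷ remove s A

smaller : ℕ → List ℕ → ℕ
smaller s σ = countTrue (map (λ y → y <ᵇ s) σ)

within : List ℕ → List ℕ → Bool
within A σ = allB (map (λ s → elem s A) σ)

elem-below : ∀ a A → All (a <_) A → elem a A ≡ false
elem-below a []      []        = refl
elem-below a (b ∷ A) (a<b ∷ <A) rewrite ≢⇒≡ᵇ-false (ℕₚ.>⇒≢ a<b) = elem-below a A <A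

smaller-below : ∀ a A → All (a <_) A → smaller a A ≡ 0
smaller-below a []      []        = refl
smaller-below a (b ∷ A) (a<b ∷ <A) rewrite ≥⇒<ᵇ-false (ℕₚ.<⇒≤ a<b) = smaller-below a A <A

remove-All : ∀ {P : ℕ → Set} s A → All P A → All P (remove s A)
remove-All s []      []       = []
remove-All s (a ∷ A) (p ∷ ps) with a ≡ᵇ s
... | true  = ps
... | false = p ∷ remove-All s A ps

remove-increasing : ∀ s A → AllPairs _<_ A → AllPairs _<_ (remove s A)
remove-increasing s []      []         = []
remove-increasing s (a ∷ A) (<A ∷ inc) with a ≡ᵇ s
... | true  = inc
... | false = remove-All s A <A ∷ remove-increasing s A inc

length-remove : ∀ s A → T (elem s A) → suc (length (remove s A)) ≡ length A
length-remove s (a ∷ A) t with a ≡ᵇ s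
... | true  = refl
... | false = cong suc (length-remove s A t)

elem-remove : ∀ s y A → AllPairs _<_ A → not (s ≡ᵇ y) ∧ elem y A ≡ elem y (remove s A)
elem-remove s y []      []         = ∧-zeroʳ (not (s ≡ᵇ y))
elem-remove s y (a ∷ A) (<A ∷ inc) with a ≡ᵇ s in a≡s
elem-remove s y (a ∷ A) (<A ∷ inc) | true with ℕₚ.≡ᵇ⇒≡ a s (subst T (sym a≡s) tt)
... | refl with a ≡ᵇ y in a≡y
... | false = refl
... | true  with ℕₚ.≡ᵇ⇒≡ a y (subst T (sym a≡y) tt)
... | refl = sym (elem-below a A <A)
elem-remove s y (a ∷ A) (<A ∷ inc) | false with a ≡ᵇ y in a≡y
... | false = elem-remove s y A inc
... | true  with ℕₚ.≡ᵇ⇒≡ a y (subst T (sym a≡y) tt)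
... | refl  = cong (_∧ true) (cong not (trans (≡ᵇ-sym s a) a≡s))

within-remove : ∀ s A σ → AllPairs _<_ A → notIn s σ ∧ within A σ ≡ within (remove s A) σ
within-remove s A []      inc = refl
within-remove s A (y ∷ σ) inc = trans
  (interchange (not (s ≡ᵇ y)) (notIn s σ) (elem y A) (within A σ))
  (cong₂ _∧_ (elem-remove s y A inc) (within-remove s A σ inc))
  where
  interchange : ∀ a b c d → (a ∧ b) ∧ (c ∧ d) ≡ (a ∧ c) ∧ (b ∧ d)
  interchange false b c     d = refl
  interchange true  b false d = ∧-zeroʳ b
  interchange true  b true  d = refl

-- In an increasing list the entries before s are exactly the smaller ones, so the positional sign
-- of `sel` becomes the count of smaller entries that `inversions` uses.
sel-increasing : ∀ f A → AllPairs _<_ A →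
  sel f A ≡ ∑ A (λ s → signPow (smaller s (remove s A)) * f (s , remove s A))
sel-increasing f []      []         = refl
sel-increasing f (a ∷ A) (<A ∷ inc) = cong₂ _+_ first (trans
  (cong -_ (sel-increasing (λ (y , v) → f (y , a ∷ v)) A inc))
  (trans (sym (neg-homo (∑-additive A) _)) (∑-cong-All (All.map (λ {s} a<s → later s a<s) <A))))
  where
  first : f (a , A) ≡ signPow (smaller a (remove a (a ∷ A))) * f (a , remove a (a ∷ A))
  first rewrite ≡ᵇ-refl a | smaller-below a A <A = sym (ℚₚ.*-identityˡ _)
  later : ∀ s → a < s → - (signPow (smaller s (remove s A)) * f (s , a ∷ remove s A)) ≡
    signPow (smaller s (remove s (a ∷ A))) * f (s , remove s (a ∷ A))
  later s a<s rewrite ≢⇒≡ᵇ-false (ℕₚ.<⇒≢ a<s) | <⇒<ᵇ-true a<s = ℚₚ.neg-distribˡ-* (signPow (smaller s (remove s A))) _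

∑-elem : ∀ k A → AllPairs _<_ A → All (_< k) A → ∀ g → ∑ (upTo k) (λ s → when (elem s A) (g s)) ≡ ∑ A g
∑-elem k []      _          _          g = 0-homo (∑-additive (upTo k))
∑-elem k (a ∷ A) (<A ∷ inc) (a<k ∷ A<) g = trans
  (∑-additive (upTo k) .ext split)
  (trans (∑-additive (upTo k) .+-homo _ _) (cong₂ _+_ (∑-upTo-δ k a a<k g) (∑-elem k A inc A< g)))
  where
  split : ∀ s → when ((a ≡ᵇ s) ∨ elem s A) (g s) ≡ when (a ≡ᵇ s) (g s) + when (elem s A) (g s)
  split s with a ≡ᵇ s in a≡s
  ... | false = sym (ℚₚ.+-identityˡ _)
  ... | true  with ℕₚ.≡ᵇ⇒≡ a s (subst T (sym a≡s) tt)
  ... | refl rewrite elem-below a A <A = sym (ℚₚ.+-identityʳ (g a))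

countTrue-↭ : ∀ {u v} → u ↭ v → countTrue u ≡ countTrue v
countTrue-↭ refl                   = refl
countTrue-↭ (prep true p)          = cong suc (countTrue-↭ p)
countTrue-↭ (prep false p)         = countTrue-↭ p
countTrue-↭ (swap true true p)     = cong (suc ∘ suc) (countTrue-↭ p)
countTrue-↭ (swap true false p)    = cong suc (countTrue-↭ p)
countTrue-↭ (swap false true p)    = cong suc (countTrue-↭ p)
countTrue-↭ (swap false false p)   = countTrue-↭ p
countTrue-↭ (_↭_.trans p q)        = trans (countTrue-↭ p) (countTrue-↭ q)

signPow-+ : ∀ m n → signPow (m ℕ.+ n) ≡ signPow m * signPow n
signPow-+ zero    n = sym (ℚₚ.*-identityˡ (signPow n))
signPow-+ (suc m) n = trans (cong -_ (signPow-+ m n)) (ℚₚ.neg-distribˡ-* (signPow m) (signPow n))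

∑-words0 : ∀ k l F → ∑ (words0 k (suc l)) F ≡ ∑ (upTo k) (λ s → ∑ (words0 k l) (λ σ → F (s ∷ σ)))
∑-words0 k l F = trans (∑-concatMap (λ s → map (s ∷_) (words0 k l)) (upTo k) F)
  (∑-additive (upTo k) .ext (λ s → ∑-map (s ∷_) (words0 k l) F))

-- A general increasing A allows the first letter s to be split off. Its inversions with the rest
-- number `smaller s σ`, which depends only on s because σ arranges `remove s A`; so this sign
-- leaves the inner sum and is the one in `sel-increasing`.
∑-distinct : ∀ k l G A → length A ≡ l → AllPairs _<_ A → All (_< k) A →
  ∑ (words0 k l) (λ σ → when (distinct σ ∧ within A σ) (sgn σ * G σ)) ≡ signedSum l G A
∑-distinct k zero    G [] len inc A< = trans (ℚₚ.+-identityʳ _) (ℚₚ.*-identityˡ (G []))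
∑-distinct k (suc l) G A  len inc A< = begin
  ∑ (words0 k (suc l)) (λ σ → when (distinct σ ∧ within A σ) (sgn σ * G σ))
    ≡⟨ ∑-words0 k l _ ⟩
  ∑ (upTo k) (λ s → ∑ (words0 k l) (λ σ → when ((notIn s σ ∧ distinct σ) ∧ (elem s A ∧ within A σ)) (sgn (s ∷ σ) * G (s ∷ σ))))
    ≡⟨ ∑-additive (upTo k) .ext (λ s → trans
         (∑-additive (words0 k l) .ext (λ σ → trans
           (cong₂ when (rearrange s σ) (sgn-∷ s σ))
           (when-∧ (elem s A) (distinct σ ∧ within (remove s A) σ) _)))
         (when-homo (∑-additive (words0 k l)) (elem s A) _)) ⟩
  ∑ (upTo k) (λ s → when (elem s A) (∑ (words0 k l) (λ σ →
    when (distinct σ ∧ within (remove s A) σ) (sgn σ * (signPow (smaller s σ) * G (s ∷ σ))))))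
    ≡⟨ ∑-additive (upTo k) .ext (λ s → when-T (elem s A) (λ s∈A → inner s (ℕₚ.suc-injective (trans (length-remove s A s∈A) len)))) ⟩
  ∑ (upTo k) (λ s → when (elem s A) (signPow (smaller s (remove s A)) * signedSum l (λ σ → G (s ∷ σ)) (remove s A)))
    ≡⟨ ∑-elem k A inc A< _ ⟩
  ∑ A (λ s → signPow (smaller s (remove s A)) * signedSum l (λ σ → G (s ∷ σ)) (remove s A))
    ≡⟨ sel-increasing (λ (s , v) → signedSum l (λ σ → G (s ∷ σ)) v) A inc ⟨
  signedSum (suc l) G A  ∎
  where
  rearrange : ∀ s σ → (notIn s σ ∧ distinct σ) ∧ (elem s A ∧ within A σ) ≡ elem s A ∧ (distinct σ ∧ within (remove s A) σ)
  rearrange s σ = trans (shuffle (notIn s σ) (distinct σ) (elem s A) (within A σ))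
    (cong (λ t → elem s A ∧ (distinct σ ∧ t)) (within-remove s A σ inc))
    where
    shuffle : ∀ a b c d → (a ∧ b) ∧ (c ∧ d) ≡ c ∧ (b ∧ (a ∧ d))
    shuffle false false false d = refl
    shuffle false false true  d = refl
    shuffle false true  false d = refl
    shuffle false true  true  d = refl
    shuffle true  false false d = refl
    shuffle true  false true  d = refl
    shuffle true  true  false d = refl
    shuffle true  true  true  d = refl
  sgn-∷ : ∀ s σ → sgn (s ∷ σ) * G (s ∷ σ) ≡ sgn σ * (signPow (smaller s σ) * G (s ∷ σ))
  sgn-∷ s σ = trans (cong (_* G (s ∷ σ)) (trans (signPow-+ (smaller s σ) (inversions σ)) (ℚₚ.*-comm (signPow (smaller s σ)) (sgn σ))))
    (ℚₚ.*-assoc (sgn σ) (signPow (smaller s σ)) (G (s ∷ σ)))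
  inner : ∀ s → length (remove s A) ≡ l →
    ∑ (words0 k l) (λ σ → when (distinct σ ∧ within (remove s A) σ) (sgn σ * (signPow (smaller s σ) * G (s ∷ σ)))) ≡
    signPow (smaller s (remove s A)) * signedSum l (λ σ → G (s ∷ σ)) (remove s A)
  inner s len′ = trans
    (∑-distinct k l (λ σ → signPow (smaller s σ) * G (s ∷ σ)) (remove s A) len′ (remove-increasing s A inc) (remove-All s A A<))
    (trans
      (signedSum-ext-↭ l (remove s A) len′ (λ σ p → cong (λ n → signPow n * G (s ∷ σ)) (countTrue-↭ (map⁺ (λ y → y <ᵇ s) p))))
      (signedSum-*ˡ (signPow (smaller s (remove s A))) l (λ σ → G (s ∷ σ)) (remove s A)))

elem-∈ : ∀ {s A} → s ∈ A → elem s A ≡ true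
elem-∈ {s}         (here refl) rewrite ≡ᵇ-refl s = refl
elem-∈ {s} {a ∷ A} (there s∈)  rewrite elem-∈ s∈ = ∨-zeroʳ (a ≡ᵇ s)

words0-within : ∀ k l → All (λ σ → within (upTo k) σ ≡ true) (words0 k l)
words0-within k zero    = refl ∷ []
words0-within k (suc l) = Allₚ.concat⁺ (Allₚ.map⁺ (All.tabulate {xs = upTo k} (λ {s} s∈ →
  Allₚ.map⁺ {f = s ∷_} (All.map (λ eq → cong₂ _∧_ (elem-∈ s∈) eq) (words0-within k l)))))

∑-perms : ∀ k G → ∑ (perms k) (λ σ → sgn σ * G σ) ≡ signedSum k G (upTo k)
∑-perms k G = begin
  ∑ (perms k) (λ σ → sgn σ * G σ)
    ≡⟨ ∑-filterB distinct (words0 k k) _ ⟩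
  ∑ (words0 k k) (λ σ → when (distinct σ) (sgn σ * G σ))
    ≡⟨ ∑-cong-All (All.map (λ {σ} eq → cong (λ t → when t (sgn σ * G σ))
         (sym (trans (cong (distinct σ ∧_) eq) (∧-comm (distinct σ) true)))) (words0-within k k)) ⟩
  ∑ (words0 k k) (λ σ → when (distinct σ ∧ within (upTo k) σ) (sgn σ * G σ))
    ≡⟨ ∑-distinct k k G (upTo k) (length-upTo k) (AllPairsₚ.applyUpTo⁺₁ id k (λ i<j _ → i<j)) (All.tabulate ∈-upTo⁻) ⟩
  signedSum k G (upTo k)  ∎

-- Admissible permutations yield compositions of the size of la

rowSums : ℕ → ℕ → ℕ
rowSums i zero    = 0
rowSums i (suc l) = i ℕ.+ rowSums (suc i) l

rowSums-sum : ∀ i l f → (∀ j → f j ≡ j ℕ.+ i) → rowSums i l ≡ sumℕ (applyUpTo f l)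
rowSums-sum i zero    f eq = refl
rowSums-sum i (suc l) f eq = cong₂ ℕ._+_ (sym (eq 0))
  (rowSums-sum (suc i) l (f ∘ suc) (λ j → trans (eq (suc j)) (sym (ℕₚ.+-suc j i))))

partsFrom-positive : ∀ i la σ → T (admissibleFrom i la σ) → All (0 <_) (partsFrom i la σ)
partsFrom-positive i la []      _ = []
partsFrom-positive i la (s ∷ σ) t = ℕₚ.m<n⇒0<n∸m (ℕₚ.<ᵇ⇒< s _ (proj₁ t′)) ∷ partsFrom-positive (suc i) la σ (proj₂ t′)
  where t′ = Equivalence.to (T-∧ {s <ᵇ nth la s ℕ.+ i}) t

-- Admissibility makes the differences la_s + i - s exact, so the subtracted terms can be moved to
-- the left. For a permutation they have the same sum as the row indices and cancel.
partsFrom-sum : ∀ i la σ → T (admissibleFrom i la σ) →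
  sumℕ (partsFrom i la σ) ℕ.+ sumℕ σ ≡ sumℕ (map (nth la) σ) ℕ.+ rowSums i (length σ)
partsFrom-sum i la []      _ = refl
partsFrom-sum i la (s ∷ σ) t = begin
  (p ℕ.+ i ∸ s ℕ.+ P) ℕ.+ (s ℕ.+ sumℕ σ)                      ≡⟨ ℕ-interchange (p ℕ.+ i ∸ s) P s (sumℕ σ) ⟩
  (p ℕ.+ i ∸ s ℕ.+ s) ℕ.+ (P ℕ.+ sumℕ σ)                      ≡⟨ cong₂ ℕ._+_ (ℕₚ.m∸n+n≡m (ℕₚ.<⇒≤ (ℕₚ.<ᵇ⇒< s _ (proj₁ t′)))) (partsFrom-sum (suc i) la σ (proj₂ t′)) ⟩
  (p ℕ.+ i) ℕ.+ (sumℕ (map (nth la) σ) ℕ.+ rowSums (suc i) (length σ))  ≡⟨ ℕ-interchange p i _ _ ⟩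
  (p ℕ.+ sumℕ (map (nth la) σ)) ℕ.+ (i ℕ.+ rowSums (suc i) (length σ))  ∎
  where
  t′ = Equivalence.to (T-∧ {s <ᵇ nth la s ℕ.+ i}) t
  p = nth la s
  P = sumℕ (partsFrom (suc i) la σ)
  ℕ-interchange : ∀ a b c d → (a ℕ.+ b) ℕ.+ (c ℕ.+ d) ≡ (a ℕ.+ c) ℕ.+ (b ℕ.+ d)
  ℕ-interchange a b c d = trans (ℕₚ.+-assoc a b _) (trans (cong (a ℕ.+_)
    (trans (sym (ℕₚ.+-assoc b c d)) (trans (cong (ℕ._+ d) (ℕₚ.+-comm b c)) (ℕₚ.+-assoc c b d))))
    (sym (ℕₚ.+-assoc a c _)))

map-nth-upTo : ∀ la → map (nth la) (upTo (length la)) ≡ la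
map-nth-upTo []       = refl
map-nth-upTo (x ∷ la) = cong (x ∷_) (trans (map-applyUpTo suc (nth (x ∷ la)) (length la))
  (trans (sym (map-upTo (nth la) (length la))) (map-nth-upTo la)))

partsFrom-IsComp : ∀ la σ → σ ↭ upTo (length la) → T (admissibleFrom 0 la σ) → IsComp (sumℕ la) (partsFrom 0 la σ)
partsFrom-IsComp la σ p t = partsFrom-positive 0 la σ t , ℕₚ.+-cancelʳ-≡ (sumℕ σ) _ _ (begin
  sumℕ (partsFrom 0 la σ) ℕ.+ sumℕ σ                ≡⟨ partsFrom-sum 0 la σ t ⟩
  sumℕ (map (nth la) σ) ℕ.+ rowSums 0 (length σ)    ≡⟨ cong₂ ℕ._+_
      (trans (sum-↭ (map⁺ (nth la) p)) (cong sumℕ (map-nth-upTo la)))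
      (trans (cong (rowSums 0) (trans (↭-length p) (length-upTo (length la))))
        (trans (rowSums-sum 0 (length la) id (λ j → sym (ℕₚ.+-identityʳ j))) (sym (sum-↭ p)))) ⟩
  sumℕ la ℕ.+ sumℕ σ  ∎)

-- Both functionals evaluated on 𝔖_α

coeff-rhs : ∀ g la k γ → coeff γ (rhs g la k) ≡
  ∑ (filterB (admissibleFrom 0 la) (perms k)) (λ σ → sgn σ * coeff γ (dualElt g (sumℕ la) (partsFrom 0 la σ)))
coeff-rhs g la k γ = trans (coeff-∑ γ (rhs g la k)) (trans (∑-concatMap _ (filterB (admissibleFrom 0 la) (perms k)) _)
  (∑-additive (filterB (admissibleFrom 0 la) (perms k)) .ext (λ σ →
    let F = dualElt g (sumℕ la) (partsFrom 0 la σ) in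
    trans (∑-map _ F _) (trans (∑-additive F .ext (λ (c , β) → when-*ʳ (eqL γ β) (sgn σ) c))
      (trans (∑-*ˡ (sgn σ) F _) (cong (sgn σ *_) (sym (coeff-∑ γ F))))))))

ev-∑ : ∀ {A : Set} L (xs : List A) (c : A → ℚ) (F : A → List ℕ → ℚ) →
  ev L (λ γ → ∑ xs (λ x → c x * F x γ)) ≡ ∑ xs (λ x → c x * ev L (F x))
ev-∑ L xs c F = trans
  (∑-additive L .ext (λ (d , γ) → trans (sym (∑-*ˡ d xs _)) (∑-additive xs .ext (λ x → rotate d (c x) (F x γ)))))
  (trans (∑-swap (∑-additive L) xs (λ x (d , γ) → c x * (d * F x γ))) (∑-additive xs .ext (λ x → ∑-*ˡ (c x) L _)))
  where
  rotate : ∀ d c f → d * (c * f) ≡ c * (d * f)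
  rotate = solve 3 (λ d c f → d :* (c :* f) := c :* (d :* f)) refl

allB-positive : ∀ la → T (allB (map (λ x → 0 <ᵇ x) la)) → ∀ s → s < length la → 0 < nth la s
allB-positive (x ∷ la) t zero    _       = ℕₚ.<ᵇ⇒< 0 x (proj₁ (Equivalence.to T-∧ t))
allB-positive (x ∷ la) t (suc s) (s≤s l) = allB-positive la (proj₂ (Equivalence.to (T-∧ {0 <ᵇ x}) t)) s l

ev-𝔖-schur : ∀ la → T (decreasing la) → ∀ α → IsComp (sumℕ la) α →
  ev (𝔖 α) (λ γ → coeff γ (schur la)) ≡ 𝔇 α (beads la)
ev-𝔖-schur la dec α (pos , sum) = trans
  (ev-cong-All (𝔖-IsComp α pos) (λ γ isc → trans
    (coeff-comps (proj₁ isc , trans (proj₂ isc) sum) (λ β → ℤ.+ ssytCount la β / 1))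
    (ssytCount-ψ la γ dec)))
  (ev-𝔖-ψ α (beads la) pos)

ev-𝔖-rhs : ∀ la → T (isPartition la) → ∀ g →
  (∀ α β → α ∈ comps (sumℕ la) → β ∈ comps (sumℕ la) → pair (𝔖 α) (dualElt g (sumℕ la) β) ≡ δ α β) →
  ∀ α → IsComp (sumℕ la) α → ev (𝔖 α) (λ γ → coeff γ (rhs g la (length la))) ≡ 𝔇 α (beads la)
ev-𝔖-rhs la part g dual α isc = begin
  ev (𝔖 α) (λ γ → coeff γ (rhs g la k))
    ≡⟨ ∑-additive (𝔖 α) .ext (λ (c , γ) → cong (c *_) (coeff-rhs g la k γ)) ⟩
  ev (𝔖 α) (λ γ → ∑ (filterB (admissibleFrom 0 la) (perms k)) (λ σ → sgn σ * coeff γ (E σ)))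
    ≡⟨ ev-∑ (𝔖 α) (filterB (admissibleFrom 0 la) (perms k)) sgn (λ σ γ → coeff γ (E σ)) ⟩
  ∑ (filterB (admissibleFrom 0 la) (perms k)) (λ σ → sgn σ * ev (𝔖 α) (λ γ → coeff γ (E σ)))
    ≡⟨ ∑-filterB (admissibleFrom 0 la) (perms k) _ ⟩
  ∑ (perms k) (λ σ → when (admissibleFrom 0 la σ) (sgn σ * ev (𝔖 α) (λ γ → coeff γ (E σ))))
    ≡⟨ ∑-additive (perms k) .ext (λ σ → when-*ʳ (admissibleFrom 0 la σ) (sgn σ) _) ⟩
  ∑ (perms k) (λ σ → sgn σ * when (admissibleFrom 0 la σ) (ev (𝔖 α) (λ γ → coeff γ (E σ))))
    ≡⟨ ∑-perms k _ ⟩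
  signedSum k (λ σ → when (admissibleFrom 0 la σ) (ev (𝔖 α) (λ γ → coeff γ (E σ)))) (upTo k)
    -- Duality is available for compositions of the size of la, and `partsFrom-IsComp` obtains one
    -- from an admissible arrangement of `upTo k`. Hence duality is used only after the sum over
    -- `perms` has become `signedSum`, whose arguments are known to be such arrangements.
    ≡⟨ signedSum-ext-↭ k (upTo k) (length-upTo k) (λ σ p → trans
         (when-T (admissibleFrom 0 la σ) (λ t → trans (sym (pair-ev (𝔖 α) (E σ)))
           (dual α (partsFrom 0 la σ) (∈-comps isc) (∈-comps (partsFrom-IsComp la σ p t)))))
         (sym (when-∧ (admissibleFrom 0 la σ) (eqL α (partsFrom 0 la σ)) 1ℚ))) ⟩
  signedSum k (λ σ → when (matches la 0 α σ) 1ℚ) (upTo k)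
    ≡⟨ 𝔇-signedSum la (allB-positive la (proj₁ (Equivalence.to T-∧ part))) α (proj₁ isc) k 0 (upTo k)
         (length-upTo k) (ℕₚ.+-identityʳ k) (All.tabulate ∈-upTo⁻) ⟨
  𝔇 α (map (beadAt la) (upTo k))
    ≡⟨ cong (𝔇 α) (beads-upTo la) ⟩
  𝔇 α (beads la)  ∎
  where
  k = length la
  E : List ℕ → Lin
  E σ = dualElt g (sumℕ la) (partsFrom 0 la σ)

map-comps-IsComp : ∀ n (G : List ℕ → ℚ) → All (λ (_ , β) → IsComp n β) (map (λ β → (G β , β)) (comps n))
map-comps-IsComp n G = Allₚ.map⁺ (comps-IsComp n)

rhs-IsComp : ∀ g la k → All (λ (_ , β) → IsComp (sumℕ la) β) (rhs g la k)
rhs-IsComp g la k = Allₚ.concat⁺ (Allₚ.map⁺ (All.universal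
  (λ σ → Allₚ.map⁺ (map-comps-IsComp (sumℕ la) (g (partsFrom 0 la σ))))
  (filterB (admissibleFrom 0 la) (perms k))))

theorem3p38 : (la : List ℕ) → T (isPartition la) → (k : ℕ) → length la ≡ k →
    (g : List ℕ → List ℕ → ℚ) →
    (∀ α β → α ∈ comps (sumℕ la) → β ∈ comps (sumℕ la) →
    pair (𝔖 α) (dualElt g (sumℕ la) β) ≡ δ α β) →
    ∀ γ → coeff γ (schur la) ≡ coeff γ (rhs g la k)
theorem3p38 la part k refl g dual γ with γ ∈? comps (sumℕ la)
... | yes γ∈ = 𝔖-spans (sumℕ la) (<-wellFounded _) (λ β → coeff β (schur la)) (λ β → coeff β (rhs g la k))
  (λ α isc → trans (ev-𝔖-schur la (proj₂ (Equivalence.to (T-∧ {allB (map (λ x → 0 <ᵇ x) la)}) part)) α isc) (sym (ev-𝔖-rhs la part g dual α isc)))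
  γ (All.lookup (comps-IsComp (sumℕ la)) γ∈)
... | no γ∉  = trans
  (coeff-outside (schur la) (map-comps-IsComp (sumℕ la) _) γ∉)
  (sym (coeff-outside (rhs g la k) (rhs-IsComp g la k) γ∉))
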